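{- Let $p$ be a prime and suppose $E\subset\mathbb{F}_p^2$ $1$-tiles $\mathbb{F}_p^2$ by $A\subset \mathbb{F}_p^2$. Then $E$ is a graph. More precisely, either $|E|=1$ and $A=\mathbb{F}_p^2$, or $E=\mathbb{F}_p^2$ and $|A|=1$, or there is a basis $\{e_1,e_2\}$ of $\mathbb{F}_p^2$ and a function $f:\mathbb{F}_p\to\mathbb{F}_p$ such that $E=\{x e_1 + f(x) e_2 : x\in\mathbb{F}_p\}$. Moreover, the function $f$ can always be given by a polynomial of degree at most $p-1$.
   Context: $E$ $k$-tiles $\mathbb{F}_p^d$ by $A$ means $\sum_{a\in A}1_E(x-a)=k$ for every $x\in\mathbb{F}_p^d$. A set $E\subset\mathbb{F}_p^d$ is a graph if there exist an integer $0\le s\le d$, a basis $e_1,\dots,e_d$ of $\mathbb{F}_p^d$ and a function $f=(f_1,\dots,f_{d-s}):\mathbb{F}_p^s\to\mathbb{F}_p^{d-s}$ such that $E=\{\sum_{i=1}^s x_i e_i+\sum_{j=1}^{d-s} f_j(x)e_{s+j} : x=(x_1,\dots,x_s)\in\mathbb{F}_p^s\}$ (i.e., $E$ is the graph of $f$ with respect to this coordinate decomposition). -}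

module Defs where

open import Data.Nat using (ℕ; zero; suc; NonZero)
import Data.Nat as ℕ
open import Data.Nat.DivMod using (_mod_)
open import Data.Fin using (Fin; toℕ)
open import Data.Bool using (Bool; true; false; if_then_else_; _∧_)
open import Data.List using (List; map; allFin; cartesianProduct; foldr)
open import Data.Nat.ListAction using (sum)
open import Data.Product using (_×_; _,_; ∃; Σ)
open import Relation.Binary.PropositionalEquality using (_≡_)

F : (p : ℕ) → Set
F p = Fin p

module _ {p : ℕ} .{{_ : NonZero p}} where

  0F : F p
  0F = 0 mod p

  1F : F p
  1F = 1 mod p

  _+F_ : F p → F p → F p
  a +F b = (toℕ a ℕ.+ toℕ b) mod p

  _*F_ : F p → F p → F p
  a *F b = (toℕ a ℕ.* toℕ b) mod p

  -F_ : F p → F p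
  -F a = (p ℕ.∸ toℕ a) mod p

  _-F_ : F p → F p → F p
  a -F b = a +F (-F b)

  _^F_ : F p → ℕ → F p
  x ^F zero = 1F
  x ^F suc n = x *F (x ^F n)

V : (p : ℕ) → Set
V p = F p × F p

module _ {p : ℕ} .{{_ : NonZero p}} where

  0V : V p
  0V = 0F , 0F

  _+V_ : V p → V p → V p
  (a , b) +V (c , d) = (a +F c) , (b +F d)

  _-V_ : V p → V p → V p
  (a , b) -V (c , d) = (a -F c) , (b -F d)

  _·V_ : F p → V p → V p
  t ·V (a , b) = (t *F a) , (t *F b)

allF : (p : ℕ) → List (F p)
allF p = allFin p

allV : (p : ℕ) → List (V p)
allV p = cartesianProduct (allF p) (allF p)

SubsetV : (p : ℕ) → Set
SubsetV p = V p → Bool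

indicator : Bool → ℕ
indicator b = if b then 1 else 0

card : {p : ℕ} → SubsetV p → ℕ
card {p} S = sum (map (λ v → indicator (S v)) (allV p))

KTiles : {p : ℕ} .{{_ : NonZero p}} → ℕ → SubsetV p → SubsetV p → Set
KTiles {p} k E A =
  ∀ (x : V p) → sum (map (λ a → indicator (A a ∧ E (x -V a))) (allV p)) ≡ k

IsBasis : {p : ℕ} .{{_ : NonZero p}} → V p → V p → Set
IsBasis {p} e₁ e₂ =
  (∀ (a b : F p) → (a ·V e₁) +V (b ·V e₂) ≡ 0V → (a ≡ 0F) × (b ≡ 0F))
  × (∀ (v : V p) → ∃ λ (ab : F p × F p) →
       v ≡ (Data.Product.proj₁ ab ·V e₁) +V (Data.Product.proj₂ ab ·V e₂))

-- Evaluation of the polynomial  Σ_{i=0}^{p-1} c_i x^i  (degree ≤ p - 1).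
evalPoly : {p : ℕ} .{{_ : NonZero p}} → (Fin p → F p) → F p → F p
evalPoly {p} c x = foldr (λ i acc → (c i *F (x ^F toℕ i)) +F acc) 0F (allFin p)

{-# OPTIONS --safe #-}

-- A tiling gives |E||A| = p². If A has two points a ≠ b, project the plane along a - b.
-- The fibre counts of E and A under this projection, seen as integer functions on ℤ/p,
-- have constant convolution. In ℤ[ℤ/p] modulo the norm element (that is, in ℤ[ζ_p]) this
-- forces one of the two counts to be constant: the product of the totals is divisible by
-- p, so one factor is a constant plus a difference D h, D can be cancelled, and the
-- argument repeats; since D^p is divisible by p on p-periodic functions, bounded functions
-- that can be divided by D arbitrarily often are constant. A constant count c divides p.
-- The count of A is at least 2 on the fibre through a and b, so if it is constant then
-- A is everything; if the count of E is constant then it is 1 (E is a graph along a - b)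
-- or p (E is everything).

module Submission where

open import Defs
open import Algebra.Bundles using (CommutativeRing)
import Algebra.Properties.AbelianGroup
import Algebra.Solver.Ring.NaturalCoefficients.Default
open import Data.Bool using (Bool; true; false; _∧_)
open import Data.Fin using (Fin; toℕ; zero; suc)
import Data.Fin.Properties as Fin
open import Data.Integer using (ℤ; +_; _+_; _*_; _-_; -_; 0ℤ; 1ℤ; ∣_∣)
open import Data.Integer.Divisibility.Signed using (_∣_; divides; ∣ᵤ⇒∣; ∣⇒∣ᵤ; ∣m∣n⇒∣m+n; ∣m⇒∣-m; ∣m⇒∣m*n)
import Data.Integer.Properties as ℤ
open import Data.Integer.Tactic.RingSolver using (solve-∀)
open import Data.List using (List; []; _∷_; length; map; tabulate; allFin; foldr; cartesianProduct)
open import Data.List.Membership.Propositional using (_∈_)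
open import Data.List.Membership.Propositional.Properties using (∈-allFin; ∈-cartesianProduct⁺; ∈-map⁺)
open import Data.List.Membership.Propositional.Properties.WithK using (unique∧set⇒bag)
open import Data.List.Properties using (length-tabulate; length-++; length-map; map-cong; map-∘)
open import Data.List.Relation.Binary.BagAndSetEquality using (∼bag⇒↭)
open import Data.List.Relation.Binary.Permutation.Propositional using (_↭_)
import Data.List.Relation.Binary.Permutation.Propositional.Properties as ↭
import Data.List.Relation.Unary.All as All
open import Data.List.Relation.Unary.AllPairs using ([]; _∷_)
open import Data.List.Relation.Unary.Any using (here; there)
open import Data.List.Relation.Unary.Unique.Propositional using (Unique)
open import Data.List.Relation.Unary.Unique.Propositional.Properties using (allFin⁺; cartesianProduct⁺; map⁺)
open import Data.Nat using (ℕ; zero; suc; z≤n; s≤s; NonZero)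
import Data.Nat as ℕ
open import Data.Nat.Combinatorics using (_C_; nCn≡1; nC1≡n; nCk≡nC[n∸k]; k>n⇒nCk≡0; nCk+nC[k+1]≡[n+1]C[k+1])
open import Data.Nat.Coprimality using (prime⇒coprime; coprime-Bézout)
import Data.Nat.Divisibility as ℕ∣
open import Data.Nat.DivMod using (_mod_; _%_; %-distribˡ-+; %-distribˡ-*; m%n<n; m<n⇒m%n≡m; n%n≡0; [m+n]%n≡m%n; [m+kn]%n≡m%n)
open import Data.Nat.GCD using (module Bézout)
open import Data.Nat.ListAction using () renaming (sum to sumᴸ)
open import Data.Nat.ListAction.Properties using (sum-↭)
open import Data.Nat.Primality using (Prime; euclidsLemma; prime⇒nonTrivial; prime⇒irreducible)
import Data.Nat.Properties as ℕ
import Data.Nat.Tactic.RingSolver as ℕSolver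
open import Data.Product using (_×_; _,_; ∃; proj₁; proj₂)
open import Data.Product.Properties using (≡-dec)
open import Data.Sum using (_⊎_; inj₁; inj₂)
import Data.Sum as Sum
open import Function using (_∘_; id)
open import Function.Bundles using (_⇔_; mk⇔)
open import Level using (0ℓ)
open import Relation.Binary.Definitions using (DecidableEquality)
open import Relation.Binary.PropositionalEquality using (_≡_; _≢_; _≗_; refl; sym; trans; cong; cong₂; subst; isEquivalence; module ≡-Reasoning)
open import Relation.Nullary using (contradiction; yes; no; does)
open import Relation.Nullary.Decidable using (does-⇔; dec-true; dec-false)
open import Algebra.Properties.AbelianGroup ℤ.+-0-abelianGroup using (∙-cancelˡ)
open import Algebra.Properties.Semiring.Sum ℤ.+-*-semiring using (sum; sum-cong-≗; ∑-comm; ∑-distrib-+; *-distribˡ-sum; *-distribʳ-sum)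

-- Integer sums over initial segments of the naturals

Σ< : ℕ → (ℕ → ℤ) → ℤ
Σ< n f = sum {n} (f ∘ toℕ)

Σ<-cong : ∀ n {f g : ℕ → ℤ} → f ≗ g → Σ< n f ≡ Σ< n g
Σ<-cong n f≗g = sum-cong-≗ {n} (f≗g ∘ toℕ)

Σ<-last : ∀ n f → Σ< (suc n) f ≡ Σ< n f + f n
Σ<-last zero    f = trans (ℤ.+-identityʳ (f 0)) (sym (ℤ.+-identityˡ (f 0)))
Σ<-last (suc n) f = trans (cong (_+_ (f 0)) (Σ<-last n (f ∘ suc))) (sym (ℤ.+-assoc (f 0) _ _))

Σ<-distrib-+ : ∀ n f g → Σ< n (λ i → f i + g i) ≡ Σ< n f + Σ< n g
Σ<-distrib-+ n f g = ∑-distrib-+ {n} (f ∘ toℕ) (g ∘ toℕ)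

Σ<-const : ∀ n c → Σ< n (λ _ → c) ≡ + n * c
Σ<-const zero    c = sym (ℤ.*-zeroˡ c)
Σ<-const (suc n) c = trans (cong (_+_ c) (Σ<-const n c)) (sym (ℤ.suc-* (+ n) c))

*-distribˡ-Σ< : ∀ n c f → c * Σ< n f ≡ Σ< n (λ i → c * f i)
*-distribˡ-Σ< n c f = *-distribˡ-sum {n} c (f ∘ toℕ)

∣-Σ< : ∀ n d f → (∀ i → i ℕ.< n → d ∣ f i) → d ∣ Σ< n f
∣-Σ< zero    d f d∣f = divides 0ℤ (sym (ℤ.*-zeroˡ d))
∣-Σ< (suc n) d f d∣f = ∣m∣n⇒∣m+n (d∣f 0 ℕ.z<s) (∣-Σ< n d (f ∘ suc) (λ i i<n → d∣f (suc i) (s≤s i<n)))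

-- Forward differences of integer sequences

D : (ℕ → ℤ) → ℕ → ℤ
D f n = f (suc n) - f n

D^ : ℕ → (ℕ → ℤ) → ℕ → ℤ
D^ zero    f = f
D^ (suc k) f = D (D^ k f)

D^-cong : ∀ k {f g : ℕ → ℤ} → f ≗ g → D^ k f ≗ D^ k g
D^-cong zero    f≗g n = f≗g n
D^-cong (suc k) f≗g n = cong₂ _-_ (D^-cong k f≗g (suc n)) (D^-cong k f≗g n)

D^-+ : ∀ j k f → D^ (j ℕ.+ k) f ≡ D^ j (D^ k f)
D^-+ zero    k f = refl
D^-+ (suc j) k f = cong D (D^-+ j k f)

D^-suc : ∀ k f → D^ (suc k) f ≡ D^ k (D f)
D^-suc k f = trans (cong (λ i → D^ i f) (ℕ.+-comm 1 k)) (D^-+ k 1 f)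

D^-* : ∀ k c f → D^ k (λ n → c * f n) ≗ λ n → c * D^ k f n
D^-* zero    c f n = refl
D^-* (suc k) c f n = trans (cong₂ _-_ (D^-* k c f (suc n)) (D^-* k c f n)) (distrib c _ _)
  where
  distrib : ∀ c x y → c * x - c * y ≡ c * (x - y)
  distrib = solve-∀

D≗0⇒const : ∀ f → (∀ n → D f n ≡ 0ℤ) → ∀ n → f n ≡ f 0
D≗0⇒const f Df≡0 zero    = refl
D≗0⇒const f Df≡0 (suc n) = trans (ℤ.i-j≡0⇒i≡j _ _ (Df≡0 n)) (D≗0⇒const f Df≡0 n)

-- Newton's forward difference formula and binomial coefficients

nC0≡1 : ∀ n → n C 0 ≡ 1
nC0≡1 n = trans (nCk≡nC[n∸k] {0} {n} z≤n) (nCn≡1 n)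

-- Induction on `m` with the base point moved from `n` to `suc n`: each `D^ k f (suc n)` is
-- `D^ (suc k) f n + D^ k f n`, and Pascal's rule merges the two resulting sums.
newton : ∀ m f n → f (n ℕ.+ m) ≡ Σ< (suc m) (λ k → + (m C k) * D^ k f n)
newton zero    f n = begin
  f (n ℕ.+ 0)          ≡⟨ cong f (ℕ.+-identityʳ n) ⟩
  f n                  ≡⟨ one (f n) ⟩
  + 1 * f n + 0ℤ       ∎
  where
  open ≡-Reasoning
  one : ∀ x → x ≡ + 1 * x + 0ℤ
  one = solve-∀
newton (suc m) f n = begin
  f (n ℕ.+ suc m)
    ≡⟨ cong f (ℕ.+-suc n m) ⟩
  f (suc n ℕ.+ m)
    ≡⟨ newton m f (suc n) ⟩
  Σ< (suc m) (λ k → c k * D^ k f (suc n))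
    ≡⟨ Σ<-cong (suc m) (λ k → step (c k) (D^ k f (suc n)) (u k)) ⟩
  Σ< (suc m) (λ k → c k * u (suc k) + c k * u k)
    ≡⟨ Σ<-distrib-+ (suc m) (λ k → c k * u (suc k)) (λ k → c k * u k) ⟩
  X + Σ< (suc m) (λ k → c k * u k)
    ≡⟨ cong (_+_ X) split ⟩
  X + (u 0 + Σ< (suc m) (λ k → c (suc k) * u (suc k)))
    ≡⟨ swap X (u 0) _ ⟩
  u 0 + (X + Σ< (suc m) (λ k → c (suc k) * u (suc k)))
    ≡⟨ cong (_+_ (u 0)) (Σ<-distrib-+ (suc m) (λ k → c k * u (suc k)) (λ k → c (suc k) * u (suc k))) ⟨
  u 0 + Σ< (suc m) (λ k → c k * u (suc k) + c (suc k) * u (suc k))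
    ≡⟨ cong₂ _+_ (one (u 0)) (Σ<-cong (suc m) pascal) ⟩
  + 1 * u 0 + Σ< (suc m) (λ k → + (suc m C suc k) * u (suc k))
    ≡⟨ cong (λ z → + z * u 0 + Σ< (suc m) (λ k → + (suc m C suc k) * u (suc k))) (nC0≡1 (suc m)) ⟨
  Σ< (suc (suc m)) (λ k → + (suc m C k) * u k) ∎
  where
  open ≡-Reasoning
  c u : ℕ → ℤ
  c k = + (m C k)
  u k = D^ k f n
  X : ℤ
  X = Σ< (suc m) (λ k → c k * u (suc k))
  one : ∀ x → x ≡ + 1 * x
  one = solve-∀
  step : ∀ c x y → c * x ≡ c * (x - y) + c * y
  step = solve-∀
  swap : ∀ x y z → x + (y + z) ≡ y + (x + z)
  swap = solve-∀
  pascal : ∀ k → c k * u (suc k) + c (suc k) * u (suc k) ≡ + (suc m C suc k) * u (suc k)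
  pascal k = trans (sym (ℤ.*-distribʳ-+ (u (suc k)) (c k) (c (suc k))))
                   (cong (λ z → + z * u (suc k)) (nCk+nC[k+1]≡[n+1]C[k+1] m k))
  -- The term at `suc m` can be appended because its binomial is 0; with the term at 0 taken out,
  -- the range then matches that of `X`.
  split : Σ< (suc m) (λ k → c k * u k) ≡ u 0 + Σ< (suc m) (λ k → c (suc k) * u (suc k))
  split = begin
    Σ< (suc m) (λ k → c k * u k)
      ≡⟨ ℤ.+-identityʳ _ ⟨
    Σ< (suc m) (λ k → c k * u k) + 0ℤ
      ≡⟨ cong (λ z → Σ< (suc m) (λ k → c k * u k) + + z * u (suc m)) (k>n⇒nCk≡0 (ℕ.n<1+n m)) ⟨
    Σ< (suc m) (λ k → c k * u k) + c (suc m) * u (suc m)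
      ≡⟨ Σ<-last (suc m) (λ k → c k * u k) ⟨
    c 0 * u 0 + Σ< (suc m) (λ k → c (suc k) * u (suc k))
      ≡⟨ cong (λ z → + z * u 0 + Σ< (suc m) (λ k → c (suc k) * u (suc k))) (nC0≡1 m) ⟩
    + 1 * u 0 + Σ< (suc m) (λ k → c (suc k) * u (suc k))
      ≡⟨ cong (_+ Σ< (suc m) (λ k → c (suc k) * u (suc k))) (one (u 0)) ⟨
    u 0 + Σ< (suc m) (λ k → c (suc k) * u (suc k)) ∎

-- Exhibits a multiple of the binomial as a multiple of `suc n`, so that Euclid's lemma can be
-- applied when `suc n` is prime. Pascal's rule and induction on `n` replace factorials.
C-absorption : ∀ n k → suc k ℕ.* (suc n C suc k) ≡ suc n ℕ.* (n C k)
C-absorption n zero = begin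
  1 ℕ.* (suc n C 1)  ≡⟨ cong (1 ℕ.*_) (nC1≡n (suc n)) ⟩
  1 ℕ.* suc n        ≡⟨ ℕ.*-comm 1 (suc n) ⟩
  suc n ℕ.* 1        ≡⟨ cong (suc n ℕ.*_) (nC0≡1 n) ⟨
  suc n ℕ.* (n C 0)  ∎
  where open ≡-Reasoning
C-absorption zero (suc k) = begin
  suc (suc k) ℕ.* (1 C suc (suc k)) ≡⟨ cong (suc (suc k) ℕ.*_) (k>n⇒nCk≡0 {1} {suc (suc k)} (s≤s (s≤s z≤n))) ⟩
  suc (suc k) ℕ.* 0                 ≡⟨ ℕ.*-zeroʳ (suc (suc k)) ⟩
  1 ℕ.* 0                           ≡⟨ cong (1 ℕ.*_) (k>n⇒nCk≡0 {0} {suc k} (s≤s z≤n)) ⟨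
  1 ℕ.* (0 C suc k)                 ∎
  where open ≡-Reasoning
C-absorption (suc n) (suc k) = begin
  suc (suc k) ℕ.* (suc (suc n) C suc (suc k))
    ≡⟨ cong (suc (suc k) ℕ.*_) (nCk+nC[k+1]≡[n+1]C[k+1] (suc n) (suc k)) ⟨
  suc (suc k) ℕ.* (y ℕ.+ (suc n C suc (suc k)))
    ≡⟨ expand k y (suc n C suc (suc k)) ⟩
  y ℕ.+ (suc k ℕ.* y ℕ.+ suc (suc k) ℕ.* (suc n C suc (suc k)))
    ≡⟨ cong (y ℕ.+_) (cong₂ ℕ._+_ (C-absorption n k) (C-absorption n (suc k))) ⟩
  y ℕ.+ (suc n ℕ.* (n C k) ℕ.+ suc n ℕ.* (n C suc k))
    ≡⟨ cong (y ℕ.+_) (ℕ.*-distribˡ-+ (suc n) (n C k) (n C suc k)) ⟨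
  y ℕ.+ suc n ℕ.* (n C k ℕ.+ n C suc k)
    ≡⟨ cong (λ z → y ℕ.+ suc n ℕ.* z) (nCk+nC[k+1]≡[n+1]C[k+1] n k) ⟩
  suc (suc n) ℕ.* y ∎
  where
  open ≡-Reasoning
  y : ℕ
  y = suc n C suc k
  expand : ∀ k y z → suc (suc k) ℕ.* (y ℕ.+ z) ≡ y ℕ.+ (suc k ℕ.* y ℕ.+ suc (suc k) ℕ.* z)
  expand = ℕSolver.solve-∀

-- By absorption the prime divides the product of `suc k` and the binomial, and it cannot divide the
-- smaller positive number `suc k`.
prime∣C : ∀ {q} → Prime (suc q) → ∀ k → k ℕ.< q → suc q ℕ∣.∣ (suc q C suc k)
prime∣C {q} pr k k<q with euclidsLemma (suc k) (suc q C suc k) pr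
                            (ℕ∣.divides (q C k) (trans (C-absorption q k) (ℕ.*-comm (suc q) (q C k))))
... | inj₁ p∣k = contradiction p∣k (ℕ∣.>⇒∤ (s≤s k<q))
... | inj₂ p∣C = p∣C

n<m^n : ∀ {m} → 2 ℕ.≤ m → ∀ n → n ℕ.< m ℕ.^ n
n<m^n 2≤m zero    = s≤s z≤n
n<m^n {m} 2≤m (suc n) = begin-strict
  suc n             <⟨ s≤s (n<m^n 2≤m n) ⟩
  suc (m ℕ.^ n)     ≤⟨ ℕ.+-monoˡ-≤ (m ℕ.^ n) (ℕ.≤-trans (s≤s z≤n) (n<m^n 2≤m n)) ⟩
  m ℕ.^ n ℕ.+ m ℕ.^ n  ≡⟨ cong (m ℕ.^ n ℕ.+_) (ℕ.+-identityʳ (m ℕ.^ n)) ⟨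
  2 ℕ.* m ℕ.^ n     ≤⟨ ℕ.*-monoˡ-≤ (m ℕ.^ n) 2≤m ⟩
  m ℕ.* m ℕ.^ n     ∎
  where open ℕ.≤-Reasoning

∣∧<⇒≡0 : ∀ d i → + d ∣ i → ∣ i ∣ ℕ.< d → i ≡ 0ℤ
∣∧<⇒≡0 d i d∣i ∣i∣<d with ∣ i ∣ in eq | ∣⇒∣ᵤ d∣i
... | zero  | _ = ℤ.∣i∣≡0⇒i≡0 eq
... | suc m | d∣m = contradiction d∣m (ℕ∣.>⇒∤ ∣i∣<d)

-- Periodic integer sequences and antidifferences

module Periodic (p : ℕ) .{{_ : NonZero p}} where

  -- Integer functions on ℤ/p are encoded as p-periodic sequences on ℕ, so that shifts and
  -- differences need no reduction modulo p.
  Periodic : (ℕ → ℤ) → Set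
  Periodic f = ∀ n → f (n ℕ.+ p) ≡ f n

  D^-periodic : ∀ k {f} → Periodic f → Periodic (D^ k f)
  D^-periodic zero    per n = per n
  D^-periodic (suc k) per n = cong₂ _-_ (D^-periodic k per (suc n)) (D^-periodic k per n)

  Σ<-shift₁ : ∀ {f} → Periodic f → Σ< p (f ∘ suc) ≡ Σ< p f
  Σ<-shift₁ {f} per = ∙-cancelˡ (f 0) _ _ (begin
    f 0 + Σ< p (f ∘ suc) ≡⟨ Σ<-last p f ⟩
    Σ< p f + f p         ≡⟨ cong (_+_ (Σ< p f)) (per 0) ⟩
    Σ< p f + f 0         ≡⟨ ℤ.+-comm (Σ< p f) (f 0) ⟩
    f 0 + Σ< p f         ∎)
    where open ≡-Reasoning

  Σ<-shift : ∀ n {f} → Periodic f → Σ< p (λ j → f (n ℕ.+ j)) ≡ Σ< p f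
  Σ<-shift zero    per = refl
  Σ<-shift (suc n) per = trans (Σ<-shift n (per ∘ suc)) (Σ<-shift₁ per)

  p*i≡0⇒i≡0 : ∀ i → + p * i ≡ 0ℤ → i ≡ 0ℤ
  p*i≡0⇒i≡0 i eq with ℤ.i*j≡0⇒i≡0∨j≡0 (+ p) eq
  ... | inj₁ p≡0 = contradiction (ℤ.+-injective p≡0) (ℕ.≢-nonZero⁻¹ p)
  ... | inj₂ i≡0 = i≡0

  -- A constant difference `c` makes `f` grow by `p * c` over one period, and periodicity forces
  -- this growth to be 0.
  D-const⇒≗0 : ∀ {f} c → Periodic f → (∀ n → D f n ≡ c) → ∀ n → D f n ≡ 0ℤ
  D-const⇒≗0 {f} c per Df≡c n = trans (Df≡c n) (p*i≡0⇒i≡0 c (begin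
    + p * c              ≡⟨ cancel (f 0) (+ p * c) ⟨
    (f 0 + + p * c) - f 0  ≡⟨ cong (_- f 0) (linear p) ⟨
    f p - f 0            ≡⟨ cong (_- f 0) (per 0) ⟩
    f 0 - f 0            ≡⟨ ℤ.+-inverseʳ (f 0) ⟩
    0ℤ                   ∎))
    where
    open ≡-Reasoning
    cancel : ∀ x y → (x + y) - x ≡ y
    cancel = solve-∀
    D-step : ∀ x y → x ≡ y + (x - y)
    D-step = solve-∀
    assoc : ∀ x m c → (x + m * c) + c ≡ x + (1ℤ + m) * c
    assoc = solve-∀
    zero* : ∀ x c → x ≡ x + 0ℤ * c
    zero* = solve-∀
    linear : ∀ m → f m ≡ f 0 + + m * c
    linear zero    = zero* (f 0) c
    linear (suc m) = begin
      f (suc m)           ≡⟨ D-step (f (suc m)) (f m) ⟩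
      f m + D f m         ≡⟨ cong₂ _+_ (linear m) (Df≡c m) ⟩
      (f 0 + + m * c) + c ≡⟨ assoc (f 0) (+ m) c ⟩
      f 0 + + suc m * c   ∎

  -- The mean `q` over a period is an integer by the divisibility hypothesis. Then `f - q` sums to 0
  -- over a period, so its partial sums `h` are again periodic. Modulo the norm element this says
  -- that `f` is divisible by `D`.
  antidifference : ∀ {f} → Periodic f → + p ∣ Σ< p f →
    ∃ λ q → ∃ λ h → Periodic h × (∀ n → f n ≡ q + D h n)
  antidifference {f} per (divides q Σf≡q*p) = q , h , h-periodic , Dh
    where
    open ≡-Reasoning
    h : ℕ → ℤ
    h n = Σ< n (λ j → f j + - q)
    h-suc : ∀ n → h (suc n) ≡ h n + (f n + - q)
    h-suc n = Σ<-last n (λ j → f j + - q)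
    rearrange : ∀ x y q → x ≡ q + ((y + (x + - q)) - y)
    rearrange = solve-∀
    Dh : ∀ n → f n ≡ q + D h n
    Dh n = trans (rearrange (f n) (h n) q) (cong (λ z → q + (z - h n)) (sym (h-suc n)))
    cancel : ∀ p q → q * p + p * - q ≡ 0ℤ
    cancel = solve-∀
    h-periodic : Periodic h
    h-periodic zero    = begin
      Σ< p (λ j → f j + - q)         ≡⟨ Σ<-distrib-+ p f (λ _ → - q) ⟩
      Σ< p f + Σ< p (λ _ → - q)      ≡⟨ cong₂ _+_ Σf≡q*p (Σ<-const p (- q)) ⟩
      q * + p + + p * - q            ≡⟨ cancel (+ p) q ⟩
      0ℤ                             ∎
    h-periodic (suc n) = begin
      h (suc n ℕ.+ p)                  ≡⟨ h-suc (n ℕ.+ p) ⟩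
      h (n ℕ.+ p) + (f (n ℕ.+ p) + - q) ≡⟨ cong₂ (λ x y → x + (y + - q)) (h-periodic n) (per n) ⟩
      h n + (f n + - q)                ≡⟨ h-suc n ⟨
      h (suc n)                        ∎

  -- Cyclic correlation, that is, convolution with the second factor reflected

  corr : (ℕ → ℤ) → (ℕ → ℤ) → ℕ → ℤ
  corr f g n = Σ< p (λ j → g j * f (n ℕ.+ j))

  corr-periodic : ∀ {f} g → Periodic f → Periodic (corr f g)
  corr-periodic {f} g per n = Σ<-cong p λ j → cong (g j *_) (trans (cong f (swap n p j)) (per (n ℕ.+ j)))
    where
    swap : ∀ n p j → n ℕ.+ p ℕ.+ j ≡ n ℕ.+ j ℕ.+ p
    swap = ℕSolver.solve-∀

  -- The total over a period is the augmentation of the group ring, hence multiplicative: after the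
  -- sums are exchanged, each inner sum runs over a shifted full period of `f`.
  Σ<-corr : ∀ {f} g → Periodic f → Σ< p (corr f g) ≡ Σ< p f * Σ< p g
  Σ<-corr {f} g per = begin
    Σ< p (λ n → Σ< p (λ j → g j * f (n ℕ.+ j)))
      ≡⟨ ∑-comm {p} {p} (λ n j → g (toℕ j) * f (toℕ n ℕ.+ toℕ j)) ⟩
    Σ< p (λ j → Σ< p (λ n → g j * f (n ℕ.+ j)))
      ≡⟨ Σ<-cong p (λ j → *-distribˡ-Σ< p (g j) (λ n → f (n ℕ.+ j))) ⟨
    Σ< p (λ j → g j * Σ< p (λ n → f (n ℕ.+ j)))
      ≡⟨ Σ<-cong p (λ j → cong (g j *_) (trans (Σ<-cong p (λ n → cong f (ℕ.+-comm n j))) (Σ<-shift j per))) ⟩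
    Σ< p (λ j → g j * Σ< p f)
      ≡⟨ *-distribʳ-sum {p} (Σ< p f) (g ∘ toℕ) ⟨
    Σ< p g * Σ< p f
      ≡⟨ ℤ.*-comm (Σ< p g) (Σ< p f) ⟩
    Σ< p f * Σ< p g ∎
    where open ≡-Reasoning

  -- Shifting the first argument shifts the correlation, so `D` passes through it; the constant `q`
  -- contributes `q * Σ< p g`. When `corr f g` is constant, `corr h g` therefore has constant
  -- difference.
  D-corrˡ : ∀ {f} g q h → (∀ n → f n ≡ q + D h n) → ∀ n → D (corr h g) n ≡ corr f g n - q * Σ< p g
  D-corrˡ {f} g q h f≡ n = isolate (corr f g n) (q * Σ< p g) (corr h g (suc n)) (corr h g n) (begin
    corr f g n + corr h g n
      ≡⟨ Σ<-distrib-+ p (λ j → g j * f (n ℕ.+ j)) (λ j → g j * h (n ℕ.+ j)) ⟨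
    Σ< p (λ j → g j * f (n ℕ.+ j) + g j * h (n ℕ.+ j))
      ≡⟨ Σ<-cong p (λ j → trans (cong (λ z → g j * z + g j * h (n ℕ.+ j)) (f≡ (n ℕ.+ j)))
                                (expand (g j) q (h (suc n ℕ.+ j)) (h (n ℕ.+ j)))) ⟩
    Σ< p (λ j → q * g j + g j * h (suc n ℕ.+ j))
      ≡⟨ Σ<-distrib-+ p (λ j → q * g j) (λ j → g j * h (suc n ℕ.+ j)) ⟩
    Σ< p (λ j → q * g j) + corr h g (suc n)
      ≡⟨ cong (_+ corr h g (suc n)) (*-distribˡ-Σ< p q g) ⟨
    q * Σ< p g + corr h g (suc n) ∎)
    where
    open ≡-Reasoning
    expand : ∀ g q x y → g * (q + (x - y)) + g * y ≡ q * g + g * x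
    expand = solve-∀
    isolate : ∀ a b x y → a + y ≡ b + x → x - y ≡ a - b
    isolate a b x y eq = begin
      x - y             ≡⟨ l₁ b x y ⟩
      (b + x) - y - b   ≡⟨ cong (λ z → z - y - b) eq ⟨
      (a + y) - y - b   ≡⟨ l₂ a b y ⟩
      a - b             ∎
      where
      l₁ : ∀ b x y → x - y ≡ (b + x) - y - b
      l₁ = solve-∀
      l₂ : ∀ a b y → (a + y) - y - b ≡ a - b
      l₂ = solve-∀

  -- Summation by parts: shifting `h` forward shifts its correlation backward, hence the opposite
  -- sign and the index `suc n` compared with `D-corrˡ`.
  D-corrʳ : ∀ {f g} → Periodic f → ∀ q h → Periodic h → (∀ n → g n ≡ q + D h n) →
    ∀ n → D (corr f h) n ≡ q * Σ< p f - corr f g (suc n)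
  D-corrʳ {f} {g} f-per q h h-per g≡ n =
    isolate (corr f g (suc n)) (q * Σ< p f) (corr f h (suc n)) (corr f h n) (begin
    corr f g (suc n) + corr f h (suc n)
      ≡⟨ Σ<-distrib-+ p (λ j → g j * f (suc n ℕ.+ j)) (λ j → h j * f (suc n ℕ.+ j)) ⟨
    Σ< p (λ j → g j * f (suc n ℕ.+ j) + h j * f (suc n ℕ.+ j))
      ≡⟨ Σ<-cong p (λ j → trans (cong (λ z → z * f (suc n ℕ.+ j) + h j * f (suc n ℕ.+ j)) (g≡ j))
                                (expand (f (suc n ℕ.+ j)) q (h (suc j)) (h j))) ⟩
    Σ< p (λ j → q * f (suc n ℕ.+ j) + h (suc j) * f (suc n ℕ.+ j))
      ≡⟨ Σ<-distrib-+ p (λ j → q * f (suc n ℕ.+ j)) (λ j → h (suc j) * f (suc n ℕ.+ j)) ⟩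
    Σ< p (λ j → q * f (suc n ℕ.+ j)) + Σ< p (λ j → h (suc j) * f (suc n ℕ.+ j))
      ≡⟨ cong₂ _+_ (*-distribˡ-Σ< p q (λ j → f (suc n ℕ.+ j)))
                   (Σ<-cong p (λ j → cong (λ z → h (suc j) * f z) (ℕ.+-suc n j))) ⟨
    q * Σ< p (λ j → f (suc n ℕ.+ j)) + Σ< p (λ j → h (suc j) * f (n ℕ.+ suc j))
      ≡⟨ cong₂ _+_ (cong (q *_) (Σ<-shift (suc n) f-per)) (Σ<-shift₁ hf-per) ⟩
    q * Σ< p f + corr f h n ∎)
    where
    open ≡-Reasoning
    expand : ∀ f q x y → (q + (x - y)) * f + y * f ≡ q * f + x * f
    expand = solve-∀
    hf-per : Periodic (λ j → h j * f (n ℕ.+ j))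
    hf-per j = cong₂ _*_ (h-per j) (trans (cong f (sym (ℕ.+-assoc n j p))) (f-per (n ℕ.+ j)))
    isolate : ∀ a b x y → a + x ≡ b + y → x - y ≡ b - a
    isolate a b x y eq = begin
      x - y             ≡⟨ l₁ a x y ⟩
      (a + x) - y - a   ≡⟨ cong (λ z → z - y - a) eq ⟩
      (b + y) - y - a   ≡⟨ l₂ a b y ⟩
      b - a             ∎
      where
      l₁ : ∀ a x y → x - y ≡ (a + x) - y - a
      l₁ = solve-∀
      l₂ : ∀ a b y → (b + y) - y - a ≡ b - a
      l₂ = solve-∀

  -- Divisibility of iterated differences by powers of p

  -- Newton's formula for f (n + p) = f n leaves only D^ p f and binomials divisible by p.
  prime∣D^p : Prime p → ∀ {f} → Periodic f → ∀ n → + p ∣ D^ p f n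
  prime∣D^p pr {f} per n = go p pr refl
    where
    go : ∀ p′ → Prime p′ → p′ ≡ p → + p′ ∣ D^ p′ f n
    go zero    pr′ _ = contradiction (prime⇒nonTrivial pr′) λ ()
    go (suc q) pr′ refl = subst (+ suc q ∣_) (sym u≡) (∣m⇒∣-m (∣-Σ< q (+ suc q) _
      λ k k<q → ∣m⇒∣m*n (D^ (suc k) f n) (∣ᵤ⇒∣ {+ suc q} {+ (suc q C suc k)} (prime∣C pr′ k k<q))))
      where
      open ≡-Reasoning
      t : ℕ → ℤ
      t k = + (suc q C k) * D^ k f n
      -- The terms with 0 < k < p. The term at 0 is `f n`, which periodicity cancels, and the term
      -- at p is the iterated difference sought.
      R : ℤ
      R = Σ< q (t ∘ suc)
      expansion : f n ≡ f n + R + D^ (suc q) f n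
      expansion = begin
        f n                           ≡⟨ per n ⟨
        f (n ℕ.+ suc q)               ≡⟨ newton (suc q) f n ⟩
        Σ< (suc (suc q)) t            ≡⟨ Σ<-last (suc q) t ⟩
        t 0 + R + t (suc q)           ≡⟨ cong₂ (λ x y → + x * f n + R + + y * D^ (suc q) f n) (nC0≡1 (suc q)) (nCn≡1 (suc q)) ⟩
        + 1 * f n + R + + 1 * D^ (suc q) f n
                                      ≡⟨ cong₂ (λ x y → x + R + y) (ℤ.*-identityˡ (f n)) (ℤ.*-identityˡ (D^ (suc q) f n)) ⟩
        f n + R + D^ (suc q) f n      ∎
      solved : ∀ x r u → u ≡ (x + r + u) - x - r
      solved = solve-∀
      collapse : ∀ x r → x - x - r ≡ - r
      collapse = solve-∀
      u≡ : D^ (suc q) f n ≡ - R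
      u≡ = begin
        D^ (suc q) f n                          ≡⟨ solved (f n) R _ ⟩
        (f n + R + D^ (suc q) f n) - f n - R    ≡⟨ cong (λ z → z - f n - R) expansion ⟨
        f n - f n - R                           ≡⟨ collapse (f n) R ⟩
        - R                                     ∎

  -- The quotient of `D^ (k * p) f` by `p ^ k` is itself periodic, so applying `D^ p` to it yields
  -- one more factor p.
  prime^∣D^ : Prime p → ∀ k {f} → Periodic f → ∀ n → + (p ℕ.^ k) ∣ D^ (k ℕ.* p) f n
  prime^∣D^ pr zero    {f} per n = divides (f n) (sym (ℤ.*-identityʳ (f n)))
  prime^∣D^ pr (suc k) {f} per n with prime∣D^p pr {w} w-periodic n
    where
    w : ℕ → ℤ
    w m = _∣_.quotient (prime^∣D^ pr k per m)
    instance
      p^k≢0 : NonZero (p ℕ.^ k)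
      p^k≢0 = ℕ.m^n≢0 p k
    w-periodic : Periodic w
    w-periodic m = ℤ.*-cancelʳ-≡ _ _ (+ (p ℕ.^ k)) (trans (sym (_∣_.equality (prime^∣D^ pr k per (m ℕ.+ p))))
      (trans (D^-periodic (k ℕ.* p) per m) (_∣_.equality (prime^∣D^ pr k per m))))
  ... | divides v eq = divides v (begin
    D^ (p ℕ.+ k ℕ.* p) f n     ≡⟨ cong (λ h → h n) (D^-+ p (k ℕ.* p) f) ⟩
    D^ p (D^ (k ℕ.* p) f) n    ≡⟨ D^-cong p (λ m → trans (_∣_.equality (prime^∣D^ pr k per m)) (ℤ.*-comm _ (+ (p ℕ.^ k)))) n ⟩
    D^ p (λ m → + (p ℕ.^ k) * _∣_.quotient (prime^∣D^ pr k per m)) n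
                               ≡⟨ D^-* p (+ (p ℕ.^ k)) _ n ⟩
    + (p ℕ.^ k) * D^ p (λ m → _∣_.quotient (prime^∣D^ pr k per m)) n
                               ≡⟨ cong (+ (p ℕ.^ k) *_) eq ⟩
    + (p ℕ.^ k) * (v * + p)    ≡⟨ rearrange (+ (p ℕ.^ k)) v (+ p) ⟩
    v * (+ p * + (p ℕ.^ k))    ≡⟨ cong (v *_) (ℤ.pos-* p (p ℕ.^ k)) ⟨
    v * + (p ℕ.^ suc k)        ∎)
    where
    open ≡-Reasoning
    rearrange : ∀ a v p → a * (v * p) ≡ v * (p * a)
    rearrange = solve-∀

  -- Descent by repeated cancellation of the difference operator

  -- D f = D^(i+1) f′ says that f and D^i f′ agree up to a constant; phrased with one more
  -- D, the constants split off at each step never have to be recorded.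
  record Descent (f g : ℕ → ℤ) (N : ℕ) : Set where
    field
      i j        : ℕ
      i+j≡N      : i ℕ.+ j ≡ N
      f′ g′      : ℕ → ℤ
      f′-per     : Periodic f′
      g′-per     : Periodic g′
      corr-const : ∀ n → D (corr f′ g′) n ≡ 0ℤ
      Df≗        : D f ≗ D^ (suc i) f′
      Dg≗        : D g ≗ D^ (suc j) g′

  -- The totals of `f′` and `g′` multiply to p times the constant value of their correlation, so p
  -- divides one of the totals. The corresponding sequence is a constant plus `D h`, and `h` takes
  -- its place.
  descent-step : Prime p → ∀ {f g N} → Descent f g N → Descent f g (suc N)
  descent-step pr {f} {g} {N} d = step (euclidsLemma ∣ Σ< p f′ ∣ ∣ Σ< p g′ ∣ pr p∣product)
    where
    open Descent d
    corr≡ : ∀ n → corr f′ g′ n ≡ corr f′ g′ 0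
    corr≡ = D≗0⇒const (corr f′ g′) corr-const
    product≡ : Σ< p f′ * Σ< p g′ ≡ + p * corr f′ g′ 0
    product≡ = trans (sym (Σ<-corr g′ f′-per)) (trans (Σ<-cong p corr≡) (Σ<-const p _))
    p∣product : p ℕ∣.∣ ∣ Σ< p f′ ∣ ℕ.* ∣ Σ< p g′ ∣
    p∣product = subst (p ℕ∣.∣_) (ℤ.abs-* (Σ< p f′) (Σ< p g′))
      (∣⇒∣ᵤ {+ p} (divides (corr f′ g′ 0) (trans product≡ (ℤ.*-comm (+ p) _))))
    D-cancel : ∀ q x y → (q + x) - (q + y) ≡ x - y
    D-cancel = solve-∀
    -- At least one difference is always applied, and it kills the constant `q`.
    D^-drop : ∀ k {u} q h → (∀ n → u n ≡ q + D h n) → D^ (suc k) u ≗ D^ (suc (suc k)) h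
    D^-drop k {u} q h u≡ n = begin
      D^ (suc k) u n       ≡⟨ cong (λ v → v n) (D^-suc k u) ⟩
      D^ k (D u) n         ≡⟨ D^-cong k (λ m → trans (cong₂ _-_ (u≡ (suc m)) (u≡ m)) (D-cancel q _ _)) n ⟩
      D^ k (D (D h)) n     ≡⟨ cong (λ v → v n) (D^-suc k (D h)) ⟨
      D^ (suc k) (D h) n   ≡⟨ cong (λ v → v n) (D^-suc (suc k) h) ⟨
      D^ (suc (suc k)) h n ∎
      where open ≡-Reasoning
    step : p ℕ∣.∣ ∣ Σ< p f′ ∣ ⊎ p ℕ∣.∣ ∣ Σ< p g′ ∣ → Descent f g (suc N)
    step (inj₁ p∣Σf) with antidifference f′-per (∣ᵤ⇒∣ p∣Σf)
    ... | q , h , h-per , f′≡ = record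
      { i = suc i ; j = j ; i+j≡N = cong suc i+j≡N ; f′ = h ; g′ = g′
      ; f′-per = h-per ; g′-per = g′-per
      -- This is the cancellation of `D`: the new correlation has a constant difference, which must
      -- be 0 by periodicity.
      ; corr-const = D-const⇒≗0 (corr f′ g′ 0 - q * Σ< p g′) (corr-periodic g′ h-per)
          (λ n → trans (D-corrˡ g′ q h f′≡ n) (cong (_- q * Σ< p g′) (corr≡ n)))
      ; Df≗ = λ n → trans (Df≗ n) (D^-drop i q h f′≡ n) ; Dg≗ = Dg≗ }
    step (inj₂ p∣Σg) with antidifference g′-per (∣ᵤ⇒∣ p∣Σg)
    ... | q , h , h-per , g′≡ = record
      { i = i ; j = suc j ; i+j≡N = trans (ℕ.+-suc i j) (cong suc i+j≡N) ; f′ = f′ ; g′ = h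
      ; f′-per = f′-per ; g′-per = h-per
      ; corr-const = D-const⇒≗0 (q * Σ< p f′ - corr f′ g′ 0) (corr-periodic h f′-per)
          (λ n → trans (D-corrʳ f′-per q h h-per g′≡ n) (cong (λ z → q * Σ< p f′ - z) (corr≡ (suc n))))
      ; Df≗ = Df≗ ; Dg≗ = λ n → trans (Dg≗ n) (D^-drop j q h g′≡ n) }

  descent : Prime p → ∀ {f g} → Periodic f → Periodic g → (∀ n → D (corr f g) n ≡ 0ℤ) → ∀ N → Descent f g N
  descent pr f-per g-per const zero = record
    { i = 0 ; j = 0 ; i+j≡N = refl ; f′-per = f-per ; g′-per = g-per ; corr-const = const
    ; Df≗ = λ _ → refl ; Dg≗ = λ _ → refl }
  descent pr f-per g-per const (suc N) = descent-step pr (descent pr f-per g-per const N)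

  -- After `2 * M * p` descent steps one of the sequences has been divided by `D` at least `M * p`
  -- times. Its difference is then divisible by `p ^ M`, which exceeds the bound `M`, and so
  -- vanishes.
  corr-const⇒const : Prime p → ∀ M {f g} → Periodic f → Periodic g →
    (∀ n → ∣ D f n ∣ ℕ.≤ M) → (∀ n → ∣ D g n ∣ ℕ.≤ M) →
    (∀ n → D (corr f g) n ≡ 0ℤ) → (∀ n → D f n ≡ 0ℤ) ⊎ (∀ n → D g n ≡ 0ℤ)
  corr-const⇒const pr M {f} {g} f-per g-per f≤M g≤M const =
    Sum.map (λ le → vanish {u = f} le f′-per Df≗ f≤M) (λ le → vanish {u = g} le g′-per Dg≗ g≤M) large
    where
    open Descent (descent pr f-per g-per const (M ℕ.* p ℕ.+ M ℕ.* p))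
    large : M ℕ.* p ℕ.≤ i ⊎ M ℕ.* p ℕ.≤ j
    large with M ℕ.* p ℕ.≤? i | M ℕ.* p ℕ.≤? j
    ... | yes le | _      = inj₁ le
    ... | no _   | yes le = inj₂ le
    ... | no i<  | no j<  = contradiction i+j≡N (ℕ.<⇒≢ (ℕ.+-mono-< (ℕ.≰⇒> i<) (ℕ.≰⇒> j<)))
    vanish : ∀ {k u u′} → M ℕ.* p ℕ.≤ k → Periodic u′ → D u ≗ D^ (suc k) u′ →
      (∀ n → ∣ D u n ∣ ℕ.≤ M) → ∀ n → D u n ≡ 0ℤ
    vanish {k} {u} {u′} le per Du≗ u≤M n = ∣∧<⇒≡0 (p ℕ.^ M) (D u n)
      (subst (+ (p ℕ.^ M) ∣_) (sym eq) (prime^∣D^ pr M (D^-periodic r per) n))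
      (ℕ.≤-<-trans (u≤M n) (n<m^n (ℕ.nonTrivial⇒n>1 p {{prime⇒nonTrivial pr}}) M))
      where
      r : ℕ
      r = suc k ℕ.∸ M ℕ.* p
      eq : D u n ≡ D^ (M ℕ.* p) (D^ r u′) n
      eq = trans (Du≗ n) (trans (cong (λ i → D^ i u′ n) (sym (ℕ.m+[n∸m]≡n (ℕ.≤-trans le (ℕ.n≤1+n k)))))
                                (cong (λ v → v n) (D^-+ (M ℕ.* p) r u′)))

-- The field F p and interpolation

module Field (p : ℕ) .{{_ : NonZero p}} where

  ι : ℕ → F p
  ι n = n mod p

  toℕ-ι : ∀ n → toℕ (ι n) ≡ n % p
  toℕ-ι n = Fin.toℕ-fromℕ< (m%n<n n p)

  ι-cong : ∀ {m n} → m % p ≡ n % p → ι m ≡ ι n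
  ι-cong {m} {n} eq = Fin.toℕ-injective (trans (toℕ-ι m) (trans eq (sym (toℕ-ι n))))

  ι-toℕ : ∀ a → ι (toℕ a) ≡ a
  ι-toℕ a = Fin.toℕ-injective (trans (toℕ-ι (toℕ a)) (m<n⇒m%n≡m (Fin.toℕ<n a)))

  -- Every residue is some `ι n`, and `ι` respects sums and products, so the ring laws of `F p` are
  -- inherited from those of ℕ.
  ι-elim : (P : F p → Set) → (∀ n → P (ι n)) → ∀ a → P a
  ι-elim P Pι a = subst P (ι-toℕ a) (Pι (toℕ a))

  ι-+ : ∀ m n → ι m +F ι n ≡ ι (m ℕ.+ n)
  ι-+ m n = ι-cong (trans (cong₂ (λ x y → (x ℕ.+ y) % p) (toℕ-ι m) (toℕ-ι n)) (sym (%-distribˡ-+ m n p)))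

  ι-* : ∀ m n → ι m *F ι n ≡ ι (m ℕ.* n)
  ι-* m n = ι-cong (trans (cong₂ (λ x y → (x ℕ.* y) % p) (toℕ-ι m) (toℕ-ι n)) (sym (%-distribˡ-* m n p)))

  ι-p : ι p ≡ 0F
  ι-p = ι-cong (trans (n%n≡0 p) (sym (m<n⇒m%n≡m (ℕ.>-nonZero⁻¹ p))))

  +F-assoc : ∀ a b c → (a +F b) +F c ≡ a +F (b +F c)
  +F-assoc = ι-elim _ λ l → ι-elim _ λ m → ι-elim _ λ n → begin
    (ι l +F ι m) +F ι n     ≡⟨ cong (_+F ι n) (ι-+ l m) ⟩
    ι (l ℕ.+ m) +F ι n      ≡⟨ ι-+ (l ℕ.+ m) n ⟩
    ι (l ℕ.+ m ℕ.+ n)       ≡⟨ cong ι (ℕ.+-assoc l m n) ⟩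
    ι (l ℕ.+ (m ℕ.+ n))     ≡⟨ ι-+ l (m ℕ.+ n) ⟨
    ι l +F ι (m ℕ.+ n)      ≡⟨ cong (ι l +F_) (ι-+ m n) ⟨
    ι l +F (ι m +F ι n)     ∎
    where open ≡-Reasoning

  *F-assoc : ∀ a b c → (a *F b) *F c ≡ a *F (b *F c)
  *F-assoc = ι-elim _ λ l → ι-elim _ λ m → ι-elim _ λ n → begin
    (ι l *F ι m) *F ι n     ≡⟨ cong (_*F ι n) (ι-* l m) ⟩
    ι (l ℕ.* m) *F ι n      ≡⟨ ι-* (l ℕ.* m) n ⟩
    ι (l ℕ.* m ℕ.* n)       ≡⟨ cong ι (ℕ.*-assoc l m n) ⟩
    ι (l ℕ.* (m ℕ.* n))     ≡⟨ ι-* l (m ℕ.* n) ⟨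
    ι l *F ι (m ℕ.* n)      ≡⟨ cong (ι l *F_) (ι-* m n) ⟨
    ι l *F (ι m *F ι n)     ∎
    where open ≡-Reasoning

  +F-comm : ∀ a b → a +F b ≡ b +F a
  +F-comm a b = cong ι (ℕ.+-comm (toℕ a) (toℕ b))

  *F-comm : ∀ a b → a *F b ≡ b *F a
  *F-comm a b = cong ι (ℕ.*-comm (toℕ a) (toℕ b))

  +F-identityˡ : ∀ a → 0F +F a ≡ a
  +F-identityˡ = ι-elim _ (ι-+ 0)

  *F-identityˡ : ∀ a → 1F *F a ≡ a
  *F-identityˡ = ι-elim _ λ n → trans (ι-* 1 n) (cong ι (ℕ.*-identityˡ n))

  +F-inverseʳ : ∀ a → a +F (-F a) ≡ 0F
  +F-inverseʳ a = begin
    a +F ι (p ℕ.∸ toℕ a)          ≡⟨ cong (_+F ι (p ℕ.∸ toℕ a)) (ι-toℕ a) ⟨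
    ι (toℕ a) +F ι (p ℕ.∸ toℕ a)  ≡⟨ ι-+ (toℕ a) (p ℕ.∸ toℕ a) ⟩
    ι (toℕ a ℕ.+ (p ℕ.∸ toℕ a))   ≡⟨ cong ι (ℕ.m+[n∸m]≡n (ℕ.<⇒≤ (Fin.toℕ<n a))) ⟩
    ι p                           ≡⟨ ι-p ⟩
    0F                            ∎
    where open ≡-Reasoning

  *F-distribˡ-+F : ∀ a b c → a *F (b +F c) ≡ (a *F b) +F (a *F c)
  *F-distribˡ-+F = ι-elim _ λ l → ι-elim _ λ m → ι-elim _ λ n → begin
    ι l *F (ι m +F ι n)            ≡⟨ cong (ι l *F_) (ι-+ m n) ⟩
    ι l *F ι (m ℕ.+ n)             ≡⟨ ι-* l (m ℕ.+ n) ⟩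
    ι (l ℕ.* (m ℕ.+ n))            ≡⟨ cong ι (ℕ.*-distribˡ-+ l m n) ⟩
    ι (l ℕ.* m ℕ.+ l ℕ.* n)        ≡⟨ ι-+ (l ℕ.* m) (l ℕ.* n) ⟨
    ι (l ℕ.* m) +F ι (l ℕ.* n)     ≡⟨ cong₂ _+F_ (ι-* l m) (ι-* l n) ⟨
    (ι l *F ι m) +F (ι l *F ι n)   ∎
    where open ≡-Reasoning

  commutativeRing : CommutativeRing 0ℓ 0ℓ
  commutativeRing = record
    { Carrier = F p ; _≈_ = _≡_ ; _+_ = _+F_ ; _*_ = _*F_ ; -_ = λ a → -F a ; 0# = 0F ; 1# = 1F
    ; isCommutativeRing = record
      { isRing = record
        { +-isAbelianGroup = record
          { isGroup = record
            { isMonoid = record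
              { isSemigroup = record
                { isMagma = record { isEquivalence = isEquivalence ; ∙-cong = cong₂ _+F_ }
                ; assoc = +F-assoc }
              ; identity = +F-identityˡ , λ a → trans (+F-comm a 0F) (+F-identityˡ a) }
            ; inverse = (λ a → trans (+F-comm (-F a) a) (+F-inverseʳ a)) , +F-inverseʳ
            ; ⁻¹-cong = cong (λ a → -F a) }
          ; comm = +F-comm }
        ; *-cong = cong₂ _*F_
        ; *-assoc = *F-assoc
        ; *-identity = *F-identityˡ , λ a → trans (*F-comm a 1F) (*F-identityˡ a)
        ; distrib = *F-distribˡ-+F , λ a b c → trans (*F-comm (b +F c) a)
            (trans (*F-distribˡ-+F a b c) (cong₂ _+F_ (*F-comm a b) (*F-comm a c))) }
      ; *-comm = *F-comm } }

  open CommutativeRing commutativeRing public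
    using (+-identityʳ; *-identityʳ; zeroˡ; zeroʳ; +-abelianGroup; commutativeSemiring)
  open Algebra.Properties.AbelianGroup +-abelianGroup public
    using (x∙y⁻¹≈ε⇒x≈y; //-rightDividesˡ; //-rightDividesʳ)
    renaming (∙-cancelʳ to +F-cancelʳ)
  open Algebra.Solver.Ring.NaturalCoefficients.Default commutativeSemiring public
    using (solve; _:+_; _:*_; _:=_)

  ι-inverse : Prime p → ∀ k → suc k ℕ.< p → ∃ λ b → ι (suc k) *F b ≡ 1F
  ι-inverse pr k k<p with coprime-Bézout (prime⇒coprime pr k<p)
  ... | Bézout.-+ x y eq = ι y , (begin
    ι (suc k) *F ι y    ≡⟨ *F-comm (ι (suc k)) (ι y) ⟩
    ι y *F ι (suc k)    ≡⟨ ι-* y (suc k) ⟩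
    ι (y ℕ.* suc k)     ≡⟨ cong ι eq ⟨
    ι (1 ℕ.+ x ℕ.* p)   ≡⟨ ι-cong ([m+kn]%n≡m%n 1 x p) ⟩
    1F                  ∎)
    where open ≡-Reasoning
  -- Here `1 + y * suc k = x * p`, so `ι y` inverts `ι (suc k)` up to sign and its negative is the
  -- inverse.
  ... | Bézout.+- x y eq = b , (begin
    a *F b                               ≡⟨ +-identityʳ _ ⟨
    (a *F b) +F 0F                       ≡⟨ cong ((a *F b) +F_) 1+ay≡0 ⟨
    (a *F b) +F (1F +F (a *F ι y))       ≡⟨ solve 4 (λ a u v w → (a :* u) :+ (w :+ (a :* v)) := w :+ (a :* (v :+ u))) refl a b (ι y) 1F ⟩
    1F +F (a *F (ι y +F b))              ≡⟨ cong (λ z → 1F +F (a *F z)) (+F-inverseʳ (ι y)) ⟩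
    1F +F (a *F 0F)                      ≡⟨ cong (1F +F_) (zeroʳ a) ⟩
    1F +F 0F                             ≡⟨ +-identityʳ 1F ⟩
    1F                                   ∎)
    where
    open ≡-Reasoning
    a b : F p
    a = ι (suc k)
    b = -F ι y
    1+ay≡0 : 1F +F (a *F ι y) ≡ 0F
    1+ay≡0 = begin
      1F +F (a *F ι y)          ≡⟨ cong (1F +F_) (*F-comm a (ι y)) ⟩
      1F +F (ι y *F a)          ≡⟨ cong (1F +F_) (ι-* y (suc k)) ⟩
      1F +F ι (y ℕ.* suc k)     ≡⟨ ι-+ 1 (y ℕ.* suc k) ⟩
      ι (1 ℕ.+ y ℕ.* suc k)     ≡⟨ cong ι eq ⟩
      ι (x ℕ.* p)               ≡⟨ ι-cong ([m+kn]%n≡m%n 0 x p) ⟩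
      0F                        ∎

  inverse : Prime p → ∀ a → a ≢ 0F → ∃ λ b → a *F b ≡ 1F
  inverse pr a a≢0 = go (toℕ a) (ι-toℕ a) (Fin.toℕ<n a)
    where
    go : ∀ k → ι k ≡ a → k ℕ.< p → ∃ λ b → a *F b ≡ 1F
    go zero    ι0≡a _   = contradiction (sym ι0≡a) a≢0
    go (suc k) refl k<p = ι-inverse pr k k<p

  -- Polynomials in Horner form and Newton interpolation

  horner : ∀ n → (Fin n → F p) → F p → F p
  horner zero    c x = 0F
  horner (suc n) c x = c zero +F (x *F horner n (c ∘ suc) x)

  evalPoly-horner : ∀ c x → evalPoly c x ≡ horner p c x
  evalPoly-horner c x = trans (go p 0 id λ _ → refl) (*F-identityˡ _)
    where
    -- The fold over the tail that starts at exponent `k` is a Horner value times `x ^F k`; this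
    -- factor makes the induction go through.
    go : ∀ n k (g : Fin n → Fin p) → (∀ i → toℕ (g i) ≡ k ℕ.+ toℕ i) →
      foldr (λ i acc → (c i *F (x ^F toℕ i)) +F acc) 0F (tabulate g) ≡ (x ^F k) *F horner n (c ∘ g) x
    go zero    k g g≡ = sym (zeroʳ (x ^F k))
    go (suc n) k g g≡ = trans
      (cong₂ (λ i z → (c (g zero) *F (x ^F i)) +F z) (trans (g≡ zero) (ℕ.+-identityʳ k))
        (go n (suc k) (g ∘ suc) (λ i → trans (g≡ (suc i)) (ℕ.+-suc k (toℕ i)))))
      (solve 4 (λ c y x h → (c :* y) :+ ((x :* y) :* h) := y :* (c :+ (x :* h))) refl
        (c (g zero)) (x ^F k) x (horner n (c ∘ g ∘ suc) x))

  -- Multiplying by `x + a` and adding `b` costs one coefficient. This is synthetic division run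
  -- backwards: the recursive call receives `c zero` as its constant term, and the new lowest
  -- coefficient is `b + a * c zero`.
  horner-newton : ∀ n (c : Fin n → F p) a b →
    ∃ λ (c′ : Fin (suc n) → F p) → ∀ x → horner (suc n) c′ x ≡ b +F ((x +F a) *F horner n c x)
  horner-newton zero    c a b = (λ _ → b) , λ x → cong (b +F_) (trans (zeroʳ x) (sym (zeroʳ (x +F a))))
  horner-newton (suc n) c a b with horner-newton n (c ∘ suc) a (c zero)
  ... | c′ , c′≡ = (λ { zero → b +F (a *F c zero) ; (suc i) → c′ i }) , λ x → trans
      (cong (λ z → (b +F (a *F c zero)) +F (x *F z)) (c′≡ x))
      (solve 5 (λ a b c x h → (b :+ (a :* c)) :+ (x :* (c :+ ((x :+ a) :* h))) := b :+ ((x :+ a) :* (c :+ (x :* h)))) refl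
        a b (c zero) x (horner n (c ∘ suc) x))

  -- Newton's scheme with one coefficient per node: for the first node `a`, the divided difference
  -- `(f x - f a) / (x - a)` is interpolated at the remaining nodes.
  interpolate : Prime p → ∀ {n} xs → length xs ≡ n → Unique xs → (f : F p → F p) →
    ∃ λ (c : Fin n → F p) → ∀ {x} → x ∈ xs → horner n c x ≡ f x
  interpolate pr [] refl _ f = (λ ()) , λ ()
  interpolate pr (a ∷ xs) refl (a∉xs ∷ xs!) f = proj₁ step , correct
    where
    open ≡-Reasoning
    divided : F p → F p
    divided x with x Fin.≟ a
    -- A default value: `a` is not among the remaining nodes.
    ... | yes _  = 0F
    ... | no x≢a = (f x -F f a) *F proj₁ (inverse pr (x -F a) (x≢a ∘ x∙y⁻¹≈ε⇒x≈y x a))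
    divided-correct : ∀ x → x ≢ a → (x -F a) *F divided x ≡ f x -F f a
    divided-correct x x≢a with x Fin.≟ a
    ... | yes x≡a = contradiction x≡a x≢a
    ... | no x≢a′ with inverse pr (x -F a) (x≢a′ ∘ x∙y⁻¹≈ε⇒x≈y x a)
    ...   | d , eq = begin
      (x -F a) *F ((f x -F f a) *F d) ≡⟨ solve 3 (λ u v d → u :* (v :* d) := v :* (u :* d)) refl (x -F a) (f x -F f a) d ⟩
      (f x -F f a) *F ((x -F a) *F d) ≡⟨ cong ((f x -F f a) *F_) eq ⟩
      (f x -F f a) *F 1F              ≡⟨ *-identityʳ _ ⟩
      f x -F f a                      ∎
    quotient : ∃ λ (c : Fin (length xs) → F p) → ∀ {x} → x ∈ xs → horner (length xs) c x ≡ divided x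
    quotient = interpolate pr xs refl xs! divided
    step : ∃ λ (c′ : Fin (suc (length xs)) → F p) → ∀ x →
      horner (suc (length xs)) c′ x ≡ f a +F ((x -F a) *F horner (length xs) (proj₁ quotient) x)
    step = horner-newton (length xs) (proj₁ quotient) (-F a) (f a)
    correct : ∀ {x} → x ∈ (a ∷ xs) → horner (suc (length xs)) (proj₁ step) x ≡ f x
    correct (here refl) = begin
      _                                ≡⟨ proj₂ step a ⟩
      f a +F ((a -F a) *F h)           ≡⟨ cong (λ z → f a +F (z *F h)) (+F-inverseʳ a) ⟩
      f a +F (0F *F h)                 ≡⟨ cong (f a +F_) (zeroˡ h) ⟩
      f a +F 0F                        ≡⟨ +-identityʳ (f a) ⟩
      f a                              ∎
      where
      h : F p
      h = horner (length xs) (proj₁ quotient) a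
    correct {x} (there x∈xs) = begin
      _                                ≡⟨ proj₂ step x ⟩
      f a +F ((x -F a) *F horner (length xs) (proj₁ quotient) x)
                                       ≡⟨ cong (λ z → f a +F ((x -F a) *F z)) (proj₂ quotient x∈xs) ⟩
      f a +F ((x -F a) *F divided x)   ≡⟨ cong (f a +F_) (divided-correct x (λ x≡a → All.lookup a∉xs x∈xs (sym x≡a))) ⟩
      f a +F (f x -F f a)              ≡⟨ +F-comm (f a) _ ⟩
      (f x -F f a) +F f a              ≡⟨ //-rightDividesˡ (f a) (f x) ⟩
      f x                              ∎

  -- With all p field elements as nodes, interpolation uses p coefficients, hence degree at most p -
  -- 1.
  polynomial : Prime p → (f : F p → F p) → ∃ λ (c : Fin p → F p) → ∀ x → f x ≡ evalPoly c x
  polynomial pr f with interpolate pr (allFin p) (length-tabulate id) (allFin⁺ p) f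
  ... | c , c≡f = c , λ x → sym (trans (evalPoly-horner c x) (c≡f (∈-allFin x)))

-- Sums over lists

private variable
  X Y : Set

∑ : List X → (X → ℕ) → ℕ
∑ xs h = sumᴸ (map h xs)

∑-cong : ∀ (xs : List X) {h k : X → ℕ} → h ≗ k → ∑ xs h ≡ ∑ xs k
∑-cong xs h≗k = cong sumᴸ (map-cong h≗k xs)

∑-const : ∀ (xs : List X) c → ∑ xs (λ _ → c) ≡ length xs ℕ.* c
∑-const []       c = refl
∑-const (x ∷ xs) c = cong (c ℕ.+_) (∑-const xs c)

∑-+ : ∀ (xs : List X) (h k : X → ℕ) → ∑ xs (λ x → h x ℕ.+ k x) ≡ ∑ xs h ℕ.+ ∑ xs k
∑-+ []       h k = refl
∑-+ (x ∷ xs) h k = trans (cong (h x ℕ.+ k x ℕ.+_) (∑-+ xs h k)) (interchange (h x) (k x) _ _)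
  where
  interchange : ∀ a b c d → a ℕ.+ b ℕ.+ (c ℕ.+ d) ≡ a ℕ.+ c ℕ.+ (b ℕ.+ d)
  interchange = ℕSolver.solve-∀

*-distribˡ-∑ : ∀ (xs : List X) c h → c ℕ.* ∑ xs h ≡ ∑ xs (λ x → c ℕ.* h x)
*-distribˡ-∑ []       c h = ℕ.*-zeroʳ c
*-distribˡ-∑ (x ∷ xs) c h = trans (ℕ.*-distribˡ-+ c (h x) (∑ xs h)) (cong (c ℕ.* h x ℕ.+_) (*-distribˡ-∑ xs c h))

*-distribʳ-∑ : ∀ (xs : List X) c h → ∑ xs h ℕ.* c ≡ ∑ xs (λ x → h x ℕ.* c)
*-distribʳ-∑ xs c h = trans (ℕ.*-comm (∑ xs h) c)
  (trans (*-distribˡ-∑ xs c h) (∑-cong xs (λ x → ℕ.*-comm c (h x))))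

∑-swap : ∀ (xs : List X) (ys : List Y) (h : X → Y → ℕ) →
  ∑ xs (λ x → ∑ ys (h x)) ≡ ∑ ys (λ y → ∑ xs (λ x → h x y))
∑-swap []       ys h = sym (trans (∑-const ys 0) (ℕ.*-zeroʳ (length ys)))
∑-swap (x ∷ xs) ys h = trans (cong (∑ ys (h x) ℕ.+_) (∑-swap xs ys h))
  (sym (∑-+ ys (h x) (λ y → ∑ xs (λ x′ → h x′ y))))

∑-≥ : ∀ {xs : List X} {x} (h : X → ℕ) → x ∈ xs → h x ℕ.≤ ∑ xs h
∑-≥ h (here refl)  = ℕ.m≤m+n _ _
∑-≥ h (there x∈xs) = ℕ.≤-trans (∑-≥ h x∈xs) (ℕ.m≤n+m _ _)

∑-≥₂ : ∀ {xs : List X} {x y} (h : X → ℕ) → x ≢ y → x ∈ xs → y ∈ xs → h x ℕ.+ h y ℕ.≤ ∑ xs h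
∑-≥₂ h x≢y (here refl)  (here refl)  = contradiction refl x≢y
∑-≥₂ h x≢y (here refl)  (there y∈xs) = ℕ.+-monoʳ-≤ _ (∑-≥ h y∈xs)
∑-≥₂ {x = x} {y} h x≢y (there x∈xs) (here refl)  =
  ℕ.≤-trans (ℕ.≤-reflexive (ℕ.+-comm (h x) (h y))) (ℕ.+-monoʳ-≤ _ (∑-≥ h x∈xs))
∑-≥₂ h x≢y (there x∈xs) (there y∈xs) = ℕ.≤-trans (∑-≥₂ h x≢y x∈xs y∈xs) (ℕ.m≤n+m _ _)

∑>0⇒∃ : ∀ (xs : List X) (h : X → ℕ) → 0 ℕ.< ∑ xs h → ∃ λ x → x ∈ xs × 0 ℕ.< h x
∑>0⇒∃ (x ∷ xs) h 0<∑ with h x in eq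
... | suc _ = x , here refl , subst (0 ℕ.<_) (sym eq) ℕ.z<s
... | zero with ∑>0⇒∃ xs h 0<∑
...   | y , y∈xs , 0<hy = y , there y∈xs , 0<hy

indicator>0⇒true : ∀ b → 0 ℕ.< indicator b → b ≡ true
indicator>0⇒true true _ = refl

indicator-∧ : ∀ b c → indicator (b ∧ c) ≡ indicator b ℕ.* indicator c
indicator-∧ true  c = sym (ℕ.+-identityʳ (indicator c))
indicator-∧ false c = refl

∑-indicator>1⇒∃₂ : ∀ {xs : List X} (S : X → Bool) → Unique xs → 1 ℕ.< ∑ xs (indicator ∘ S) →
  ∃ λ x → ∃ λ y → x ≢ y × S x ≡ true × S y ≡ true
∑-indicator>1⇒∃₂ {xs = x ∷ xs} S (x∉xs ∷ xs!) 1<∑ with S x in Sx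
... | false = ∑-indicator>1⇒∃₂ S xs! 1<∑
... | true with ∑>0⇒∃ xs (indicator ∘ S) (ℕ.s<s⁻¹ 1<∑)
...   | y , y∈xs , 0<Sy = x , y , All.lookup x∉xs y∈xs , Sx , indicator>0⇒true (S y) 0<Sy

∑-indicator≤length : ∀ (xs : List X) (S : X → Bool) → ∑ xs (indicator ∘ S) ℕ.≤ length xs
∑-indicator≤length []       S = z≤n
∑-indicator≤length (x ∷ xs) S with S x
... | true  = s≤s (∑-indicator≤length xs S)
... | false = ℕ.m≤n⇒m≤1+n (∑-indicator≤length xs S)

∑-indicator≡length⇒true : ∀ {xs : List X} (S : X → Bool) → ∑ xs (indicator ∘ S) ≡ length xs →
  ∀ {x} → x ∈ xs → S x ≡ true
∑-indicator≡length⇒true {xs = y ∷ xs} S eq x∈ with S y in Sy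
... | false = contradiction (∑-indicator≤length xs S) (ℕ.<⇒≱ (ℕ.≤-reflexive (sym eq)))
∑-indicator≡length⇒true {xs = y ∷ xs} S eq (here refl)  | true = Sy
∑-indicator≡length⇒true {xs = y ∷ xs} S eq (there x∈xs) | true = ∑-indicator≡length⇒true S (ℕ.suc-injective eq) x∈xs

-- A bijection permutes a complete list without repetitions, and the sum is invariant under
-- permutations.
∑-reindex : ∀ {xs : List X} → Unique xs → (∀ x → x ∈ xs) → (φ ψ : X → X) →
  (∀ x → ψ (φ x) ≡ x) → (∀ x → φ (ψ x) ≡ x) → ∀ h → ∑ xs (h ∘ φ) ≡ ∑ xs h
∑-reindex {xs = xs} xs! complete φ ψ ψφ φψ h = trans (cong sumᴸ (map-∘ xs)) (sum-↭ (↭.map⁺ h φxs↭xs))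
  where
  φxs↭xs : map φ xs ↭ xs
  φxs↭xs = ∼bag⇒↭ (unique∧set⇒bag (map⁺ (λ {x} {y} eq → trans (sym (ψφ x)) (trans (cong ψ eq) (ψφ y))) xs!) xs!
    (λ {x} → mk⇔ (λ _ → complete x) (λ _ → subst (_∈ map φ xs) (φψ x) (∈-map⁺ φ (complete (ψ x))))))

length-cartesianProduct : ∀ (xs : List X) (ys : List Y) → length (cartesianProduct xs ys) ≡ length xs ℕ.* length ys
length-cartesianProduct []       ys = refl
length-cartesianProduct (x ∷ xs) ys = trans (length-++ (map (x ,_) ys))
  (cong₂ ℕ._+_ (length-map (x ,_) ys) (length-cartesianProduct xs ys))

-- The Kronecker delta

module Delta (_≟_ : DecidableEquality X) where

  δ : X → X → ℕ
  δ x y = indicator (does (x ≟ y))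

  δ-refl : ∀ x → δ x x ≡ 1
  δ-refl x = cong indicator (dec-true (x ≟ x) refl)

  δ-cong : ∀ {x y u v} → (x ≡ y → u ≡ v) → (u ≡ v → x ≡ y) → δ x y ≡ δ u v
  δ-cong {x} {y} {u} {v} to from = cong indicator (does-⇔ (mk⇔ to from) (x ≟ y) (u ≟ v))

  ∑-δ-∉ : ∀ (xs : List X) z (h : X → ℕ) → (∀ {x} → x ∈ xs → x ≢ z) → ∑ xs (λ x → δ x z ℕ.* h x) ≡ 0
  ∑-δ-∉ []       z h z∉xs = refl
  ∑-δ-∉ (x ∷ xs) z h z∉xs = cong₂ ℕ._+_
    (cong (λ b → indicator b ℕ.* h x) (dec-false (x ≟ z) (z∉xs (here refl))))
    (∑-δ-∉ xs z h (z∉xs ∘ there))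

  ∑-δ : ∀ {xs : List X} → Unique xs → ∀ {z} → z ∈ xs → (h : X → ℕ) → ∑ xs (λ x → δ x z ℕ.* h x) ≡ h z
  ∑-δ {z ∷ xs} (z∉xs ∷ xs!) (here refl) h = begin
    δ z z ℕ.* h z ℕ.+ ∑ xs (λ x → δ x z ℕ.* h x) ≡⟨ cong₂ (λ a b → a ℕ.* h z ℕ.+ b) (δ-refl z) (∑-δ-∉ xs z h (λ x∈xs x≡z → All.lookup z∉xs x∈xs (sym x≡z))) ⟩
    1 ℕ.* h z ℕ.+ 0                              ≡⟨ trans (ℕ.+-identityʳ _) (ℕ.*-identityˡ (h z)) ⟩
    h z                                          ∎
    where open ≡-Reasoning
  ∑-δ {x ∷ xs} (x∉xs ∷ xs!) {z} (there z∈xs) h = cong₂ ℕ._+_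
    (cong (λ b → indicator b ℕ.* h x) (dec-false (x ≟ z) (All.lookup x∉xs z∈xs)))
    (∑-δ xs! z∈xs h)

-- Fibre counts in the plane

module Plane (p : ℕ) .{{_ : NonZero p}} where
  open Field p
  open Periodic p
  open Delta {X = F p} Fin._≟_

  +∑-allF : ∀ (h : F p → ℕ) → + ∑ (allF p) h ≡ Σ< p (λ i → + h (ι i))
  +∑-allF h = trans (go p id) (sum-cong-≗ {p} (λ i → cong (λ a → + h a) (sym (ι-toℕ i))))
    where
    go : ∀ n (g : Fin n → F p) → + ∑ (tabulate g) h ≡ sum (λ i → + h (g i))
    go zero    g = refl
    go (suc n) g = cong (_+_ (+ h (g zero))) (go n (g ∘ suc))

  ∑F : (F p → ℕ) → ℕ
  ∑F = ∑ (allF p)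

  ∑V : (V p → ℕ) → ℕ
  ∑V = ∑ (allV p)

  ∈-allV : ∀ v → v ∈ allV p
  ∈-allV (x , y) = ∈-cartesianProduct⁺ (∈-allFin x) (∈-allFin y)

  allV-unique : Unique (allV p)
  allV-unique = cartesianProduct⁺ (allFin⁺ p) (allFin⁺ p)

  length-allF : length (allF p) ≡ p
  length-allF = length-tabulate {n = p} id

  length-allV : length (allV p) ≡ p ℕ.* p
  length-allV = trans (length-cartesianProduct (allF p) (allF p)) (cong₂ ℕ._*_ length-allF length-allF)

  card≡p²⇒full : ∀ S → card S ≡ p ℕ.* p → ∀ v → S v ≡ true
  card≡p²⇒full S eq v = ∑-indicator≡length⇒true S (trans eq (sym length-allV)) (∈-allV v)

  +V-cancelʳ : ∀ v w → (v +V w) -V w ≡ v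
  +V-cancelʳ (a , b) (c , d) = cong₂ _,_ (//-rightDividesʳ c a) (//-rightDividesʳ d b)

  -V-cancelʳ : ∀ v w → (v -V w) +V w ≡ v
  -V-cancelʳ (a , b) (c , d) = cong₂ _,_ (//-rightDividesˡ c a) (//-rightDividesˡ d b)

  ∑V-translate : ∀ w h → ∑V (λ v → h (v +V w)) ≡ ∑V h
  ∑V-translate w = ∑-reindex allV-unique ∈-allV (_+V w) (_-V w) (λ v → +V-cancelʳ v w) (λ v → -V-cancelʳ v w)

  -- A basis together with its coordinate functions. The fibres of `π` are the lines parallel to
  -- `e₂`.
  record Coordinates : Set where
    field
      e₁ e₂ : V p
      π σ   : V p → F p
      π-+   : ∀ v w → π (v +V w) ≡ π v +F π w
      π-comb : ∀ a b → π ((a ·V e₁) +V (b ·V e₂)) ≡ a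
      σ-comb : ∀ a b → σ ((a ·V e₁) +V (b ·V e₂)) ≡ b
      comb  : ∀ v → v ≡ (π v ·V e₁) +V (σ v ·V e₂)

    isBasis : IsBasis e₁ e₂
    isBasis = (λ a b eq → trans (sym (π-comb a b)) (trans (cong π (trans eq (sym 0-comb))) (π-comb 0F 0F))
                        , trans (sym (σ-comb a b)) (trans (cong σ (trans eq (sym 0-comb))) (σ-comb 0F 0F)))
            , λ v → (π v , σ v) , comb v
      where
      0+0 : ∀ x y → (0F *F x) +F (0F *F y) ≡ 0F
      0+0 x y = trans (cong₂ _+F_ (zeroˡ x) (zeroˡ y)) (+F-identityˡ 0F)
      0-comb : (0F ·V e₁) +V (0F ·V e₂) ≡ 0V
      0-comb = cong₂ _,_ (0+0 _ _) (0+0 _ _)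

  a0+b1 : ∀ a b → (a *F 0F) +F (b *F 1F) ≡ b
  a0+b1 a b = trans (cong₂ _+F_ (zeroʳ a) (*-identityʳ b)) (+F-identityˡ b)

  a1+b0 : ∀ a b → (a *F 1F) +F (b *F 0F) ≡ a
  a1+b0 a b = trans (cong₂ _+F_ (*-identityʳ a) (zeroʳ b)) (+-identityʳ a)

  standard : Coordinates
  standard = record
    { e₁ = 1F , 0F ; e₂ = 0F , 1F ; π = proj₁ ; σ = proj₂
    ; π-+ = λ _ _ → refl ; π-comb = a1+b0 ; σ-comb = a0+b1
    ; comb = λ (x , y) → sym (cong₂ _,_ (a1+b0 x y) (a0+b1 x y)) }

  -- Here `π` sends `(x , y)` to `y - m x`, so its fibres are the lines of slope `m`.
  sheared : F p → Coordinates
  sheared m = record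
    { e₁ = 0F , 1F ; e₂ = 1F , m ; π = π ; σ = proj₁
    ; π-+ = λ (a , b) (c , d) → solve 5 (λ a b c d n → (b :+ d) :+ (n :* (a :+ c)) := (b :+ (n :* a)) :+ (d :+ (n :* c))) refl a b c d n
    ; π-comb = λ a b → trans (cong₂ (λ x y → (x +F (b *F m)) +F (n *F y)) (*-identityʳ a) (a0+b1 a b)) (shear a b)
    ; σ-comb = a0+b1
    ; comb = λ (x , y) → sym (cong₂ _,_ (a0+b1 (y +F (n *F x)) x) (trans (cong (_+F (x *F m)) (*-identityʳ _)) (unshear x y))) }
    where
    n : F p
    n = -F m
    π : V p → F p
    π (x , y) = y +F (n *F x)
    cancel : ∀ a b → a +F (b *F (m +F n)) ≡ a
    cancel a b = trans (cong (λ z → a +F (b *F z)) (+F-inverseʳ m)) (trans (cong (a +F_) (zeroʳ b)) (+-identityʳ a))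
    shear : ∀ a b → (a +F (b *F m)) +F (n *F b) ≡ a
    shear a b = trans (solve 4 (λ a b m n → (a :+ (b :* m)) :+ (n :* b) := a :+ (b :* (m :+ n))) refl a b m n) (cancel a b)
    unshear : ∀ x y → (y +F (n *F x)) +F (x *F m) ≡ y
    unshear x y = trans (solve 4 (λ x y m n → (y :+ (n :* x)) :+ (x :* m) := y :+ (x :* (m :+ n))) refl x y m n) (cancel y x)

  -- The line through the two points is vertical when their first coordinates agree; otherwise its
  -- slope is `(b - d) / (a - c)`, and shearing by this slope projects along it.
  aligned : Prime p → ∀ v w → ∃ λ K → Coordinates.π K v ≡ Coordinates.π K w
  aligned pr (a , b) (c , d) with a Fin.≟ c
  ... | yes a≡c = standard , a≡c
  ... | no a≢c with inverse pr (a -F c) (a≢c ∘ x∙y⁻¹≈ε⇒x≈y a c)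
  ...   | k , [a-c]k≡1 = sheared m , (begin
    b +F (n *F a)                                ≡⟨ cong₂ (λ x y → x +F (n *F y)) (//-rightDividesˡ d b) (//-rightDividesˡ c a) ⟨
    ((b -F d) +F d) +F (n *F ((a -F c) +F c))    ≡⟨ solve 5 (λ u d v c n → (u :+ d) :+ (n :* (v :+ c)) := (d :+ (n :* c)) :+ (u :+ (n :* v))) refl (b -F d) d (a -F c) c n ⟩
    (d +F (n *F c)) +F ((b -F d) +F (n *F (a -F c))) ≡⟨ cong (λ z → (d +F (n *F c)) +F (z +F (n *F (a -F c)))) slope ⟨
    (d +F (n *F c)) +F ((m *F (a -F c)) +F (n *F (a -F c))) ≡⟨ cong ((d +F (n *F c)) +F_) (solve 3 (λ m n u → (m :* u) :+ (n :* u) := (m :+ n) :* u) refl m n (a -F c)) ⟩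
    (d +F (n *F c)) +F ((m +F n) *F (a -F c))    ≡⟨ cong (λ z → (d +F (n *F c)) +F (z *F (a -F c))) (+F-inverseʳ m) ⟩
    (d +F (n *F c)) +F (0F *F (a -F c))          ≡⟨ cong ((d +F (n *F c)) +F_) (zeroˡ _) ⟩
    (d +F (n *F c)) +F 0F                        ≡⟨ +-identityʳ _ ⟩
    d +F (n *F c)                                ∎)
    where
    open ≡-Reasoning
    m n : F p
    m = (b -F d) *F k
    n = -F m
    slope : m *F (a -F c) ≡ b -F d
    slope = begin
      ((b -F d) *F k) *F (a -F c)   ≡⟨ solve 3 (λ u k v → (u :* k) :* v := u :* (v :* k)) refl (b -F d) k (a -F c) ⟩
      (b -F d) *F ((a -F c) *F k)   ≡⟨ cong ((b -F d) *F_) [a-c]k≡1 ⟩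
      (b -F d) *F 1F                ≡⟨ *-identityʳ _ ⟩
      b -F d                        ∎

  fibre : (V p → F p) → SubsetV p → F p → ℕ
  fibre ρ S t = ∑V (λ v → δ t (ρ v) ℕ.* indicator (S v))

  ∑-fibre : ∀ ρ S → ∑F (fibre ρ S) ≡ card S
  ∑-fibre ρ S = trans (∑-swap (allF p) (allV p) (λ t v → δ t (ρ v) ℕ.* indicator (S v)))
    (∑-cong (allV p) (λ v → ∑-δ (allFin⁺ p) (∈-allFin (ρ v)) (λ _ → indicator (S v))))

  fibre-const⇒card : ∀ ρ S c → (∀ t → fibre ρ S t ≡ c) → card S ≡ p ℕ.* c
  fibre-const⇒card ρ S c const = trans (sym (∑-fibre ρ S)) (trans (∑-cong (allF p) const)
    (trans (∑-const (allF p) c) (cong (ℕ._* c) length-allF)))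

  fibre-summand : ∀ (ρ : V p → F p) (S : SubsetV p) {t v} → t ≡ ρ v → S v ≡ true → δ t (ρ v) ℕ.* indicator (S v) ≡ 1
  fibre-summand ρ S {v = v} refl Sv = cong₂ ℕ._*_ (δ-refl (ρ v)) (cong indicator Sv)

  fibre-≥₂ : ∀ ρ S {t v w} → v ≢ w → t ≡ ρ v → t ≡ ρ w → S v ≡ true → S w ≡ true → 2 ℕ.≤ fibre ρ S t
  fibre-≥₂ ρ S {t} {v} {w} v≢w t≡ρv t≡ρw Sv Sw = subst (ℕ._≤ fibre ρ S t)
    (cong₂ ℕ._+_ (fibre-summand ρ S t≡ρv Sv) (fibre-summand ρ S t≡ρw Sw))
    (∑-≥₂ (λ v → δ t (ρ v) ℕ.* indicator (S v)) v≢w (∈-allV v) (∈-allV w))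

  fibre>0⇒∃ : ∀ ρ S t → 0 ℕ.< fibre ρ S t → ∃ λ v → t ≡ ρ v × S v ≡ true
  fibre>0⇒∃ ρ S t 0<fibre with ∑>0⇒∃ (allV p) (λ v → δ t (ρ v) ℕ.* indicator (S v)) 0<fibre
  ... | v , _ , pos with t Fin.≟ ρ v
  ...   | yes t≡ρv = v , t≡ρv , indicator>0⇒true (S v) (subst (0 ℕ.<_) (ℕ.+-identityʳ _) pos)

  ι-periodic : ∀ n → ι (n ℕ.+ p) ≡ ι n
  ι-periodic n = ι-cong ([m+n]%n≡m%n n p)

  -- Composition with `ι` turns functions on `F p` into periodic integer sequences, to which
  -- `corr-const⇒const` applies.
  F-corr-const⇒const : Prime p → (u v : F p → ℕ) →
    (∀ t → ∑F (λ j → v j ℕ.* u (t +F j)) ≡ ∑F (λ j → v j ℕ.* u (0F +F j))) →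
    (∀ t → u t ≡ u 0F) ⊎ (∀ t → v t ≡ v 0F)
  F-corr-const⇒const pr u v const = Sum.map (descend u) (descend v)
    (corr-const⇒const pr M {f u} {f v} (periodic u) (periodic v)
      (bounded u (λ t → ℕ.m≤n⇒m≤n+o _ (∑-≥ u (∈-allFin t))))
      (bounded v (λ t → ℕ.m≤n⇒m≤o+n _ (∑-≥ v (∈-allFin t))))
      (λ n → trans (cong₂ _-_ (corr≡ (suc n)) (corr≡ n))
        (ℤ.i≡j⇒i-j≡0 (cong +_ (trans (const (ι (suc n))) (sym (const (ι n))))))))
    where
    f : (F p → ℕ) → ℕ → ℤ
    f u n = + u (ι n)
    -- The sum of both totals dominates every value; since values are nonnegative, it also bounds
    -- the differences.
    M : ℕ
    M = ∑F u ℕ.+ ∑F v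
    periodic : ∀ u → Periodic (f u)
    periodic u n = cong (λ t → + u t) (ι-periodic n)
    bounded : ∀ u → (∀ t → u t ℕ.≤ M) → ∀ n → ∣ D (f u) n ∣ ℕ.≤ M
    bounded u u≤M n = ℕ.≤-trans (ℕ.≤-reflexive (cong ∣_∣ (ℤ.m-n≡m⊖n (u (ι (suc n))) (u (ι n)))))
      (ℕ.≤-trans (ℤ.∣m⊝n∣≤m⊔n (u (ι (suc n))) (u (ι n))) (ℕ.⊔-lub (u≤M _) (u≤M _)))
    corr≡ : ∀ n → corr (f u) (f v) n ≡ + ∑F (λ j → v j ℕ.* u (ι n +F j))
    corr≡ n = sym (trans (+∑-allF (λ j → v j ℕ.* u (ι n +F j))) (Σ<-cong p (λ j →
      trans (ℤ.pos-* (v (ι j)) _) (cong (λ t → + v (ι j) * + u t) (ι-+ n j)))))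
    descend : ∀ u → (∀ n → D (f u) n ≡ 0ℤ) → ∀ t → u t ≡ u 0F
    descend u Du≡0 = ι-elim _ (λ n → ℤ.+-injective (D≗0⇒const (f u) Du≡0 n))

  -- Consequences of the tiling equation

  module Tiling {E A : SubsetV p} (tiles : KTiles 1 E A) where
    𝟙E 𝟙A : V p → ℕ
    𝟙E v = indicator (E v)
    𝟙A v = indicator (A v)

    -- The tiling sum, equal to 1, is inserted into each term; exchanging the sums and translating
    -- by `a` then writes each point as `y + a`. Taking `h` constant gives the cardinalities, and
    -- taking `h` to be the indicator of a line gives the fibre counts.
    unfold : ∀ (h : V p → ℕ) → ∑V h ≡ ∑V (λ a → 𝟙A a ℕ.* ∑V (λ y → h (y +V a) ℕ.* 𝟙E y))
    unfold h = begin
      ∑V h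
        ≡⟨ ∑-cong (allV p) (λ x → trans (cong (h x ℕ.*_) (tiles x)) (ℕ.*-identityʳ (h x))) ⟨
      ∑V (λ x → h x ℕ.* ∑V (λ a → indicator (A a ∧ E (x -V a))))
        ≡⟨ ∑-cong (allV p) (λ x → trans (*-distribˡ-∑ (allV p) (h x) _) (∑-cong (allV p) (λ a →
             trans (cong (h x ℕ.*_) (indicator-∧ (A a) (E (x -V a)))) (swap (h x) (𝟙A a) _)))) ⟩
      ∑V (λ x → ∑V (λ a → 𝟙A a ℕ.* (h x ℕ.* 𝟙E (x -V a))))
        ≡⟨ ∑-swap (allV p) (allV p) (λ x a → 𝟙A a ℕ.* (h x ℕ.* 𝟙E (x -V a))) ⟩
      ∑V (λ a → ∑V (λ x → 𝟙A a ℕ.* (h x ℕ.* 𝟙E (x -V a))))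
        ≡⟨ ∑-cong (allV p) (λ a → *-distribˡ-∑ (allV p) (𝟙A a) _) ⟨
      ∑V (λ a → 𝟙A a ℕ.* ∑V (λ x → h x ℕ.* 𝟙E (x -V a)))
        ≡⟨ ∑-cong (allV p) (λ a → cong (𝟙A a ℕ.*_) (∑V-translate a (λ x → h x ℕ.* 𝟙E (x -V a)))) ⟨
      ∑V (λ a → 𝟙A a ℕ.* ∑V (λ y → h (y +V a) ℕ.* 𝟙E ((y +V a) -V a)))
        ≡⟨ ∑-cong (allV p) (λ a → cong (𝟙A a ℕ.*_) (∑-cong (allV p) (λ y → cong (λ z → h (y +V a) ℕ.* 𝟙E z) (+V-cancelʳ y a)))) ⟩
      ∑V (λ a → 𝟙A a ℕ.* ∑V (λ y → h (y +V a) ℕ.* 𝟙E y)) ∎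
      where
      open ≡-Reasoning
      swap : ∀ x y z → x ℕ.* (y ℕ.* z) ≡ y ℕ.* (x ℕ.* z)
      swap = ℕSolver.solve-∀

    card-product : card A ℕ.* card E ≡ p ℕ.* p
    card-product = begin
      card A ℕ.* card E
        ≡⟨ *-distribʳ-∑ (allV p) (card E) 𝟙A ⟩
      ∑V (λ a → 𝟙A a ℕ.* card E)
        ≡⟨ ∑-cong (allV p) (λ a → cong (𝟙A a ℕ.*_) (∑-cong (allV p) (λ y → ℕ.*-identityˡ (𝟙E y)))) ⟨
      ∑V (λ a → 𝟙A a ℕ.* ∑V (λ y → 1 ℕ.* 𝟙E y))
        ≡⟨ unfold (λ _ → 1) ⟨
      ∑V (λ _ → 1)
        ≡⟨ trans (∑-const (allV p) 1) (ℕ.*-identityʳ _) ⟩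
      length (allV p)
        ≡⟨ length-allV ⟩
      p ℕ.* p ∎
      where open ≡-Reasoning

    module _ (K : Coordinates) where
      open Coordinates K

      line : F p → ℕ
      line t = ∑V (λ v → δ t (π v))

      -- Translation by `t ·V e₁` carries the fibre of `π` over 0 onto the fibre over `t`.
      line-const : ∀ t → line t ≡ line 0F
      line-const t = trans (sym (∑V-translate w (λ v → δ t (π v)))) (∑-cong (allV p) (λ v → δ-cong (to v) (from v)))
        where
        w : V p
        w = (t ·V e₁) +V (0F ·V e₂)
        π[v+w] : ∀ v → π (v +V w) ≡ π v +F t
        π[v+w] v = trans (π-+ v w) (cong (π v +F_) (π-comb t 0F))
        to : ∀ v → t ≡ π (v +V w) → 0F ≡ π v
        to v t≡ = +F-cancelʳ t 0F (π v) (trans (+F-identityˡ t) (trans t≡ (π[v+w] v)))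
        from : ∀ v → 0F ≡ π v → t ≡ π (v +V w)
        from v 0≡ = trans (sym (+F-identityˡ t)) (trans (cong (_+F t) 0≡) (sym (π[v+w] v)))

      -- The sign on A turns the convolution coming from the tiling into the correlation
      -- for which F-corr-const⇒const is stated.
      fibre-corr : ∀ t → ∑F (λ j → fibre (λ v → -F π v) A j ℕ.* fibre π E (t +F j)) ≡ line t
      fibre-corr t = begin
        ∑F (λ j → fibre (λ v → -F π v) A j ℕ.* fibre π E (t +F j))
          ≡⟨ ∑-cong (allF p) (λ j → *-distribʳ-∑ (allV p) (fibre π E (t +F j)) (λ a → δ j (-F π a) ℕ.* 𝟙A a)) ⟩
        ∑F (λ j → ∑V (λ a → δ j (-F π a) ℕ.* 𝟙A a ℕ.* fibre π E (t +F j)))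
          ≡⟨ ∑-swap (allF p) (allV p) (λ j a → δ j (-F π a) ℕ.* 𝟙A a ℕ.* fibre π E (t +F j)) ⟩
        ∑V (λ a → ∑F (λ j → δ j (-F π a) ℕ.* 𝟙A a ℕ.* fibre π E (t +F j)))
          ≡⟨ ∑-cong (allV p) (λ a → trans (∑-cong (allF p) (λ j → ℕ.*-assoc (δ j (-F π a)) (𝟙A a) _))
               (∑-δ (allFin⁺ p) (∈-allFin (-F π a)) (λ j → 𝟙A a ℕ.* fibre π E (t +F j)))) ⟩
        ∑V (λ a → 𝟙A a ℕ.* fibre π E (t -F π a))
          ≡⟨ ∑-cong (allV p) (λ a → cong (𝟙A a ℕ.*_) (∑-cong (allV p) (λ y → cong (ℕ._* 𝟙E y) (δ-cong (to a y) (from a y))))) ⟩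
        ∑V (λ a → 𝟙A a ℕ.* ∑V (λ y → δ t (π (y +V a)) ℕ.* 𝟙E y))
          ≡⟨ unfold (λ v → δ t (π v)) ⟨
        line t ∎
        where
        open ≡-Reasoning
        to : ∀ a y → t -F π a ≡ π y → t ≡ π (y +V a)
        to a y eq = trans (sym (//-rightDividesˡ (π a) t)) (trans (cong (_+F π a) eq) (sym (π-+ y a)))
        from : ∀ a y → t ≡ π (y +V a) → t -F π a ≡ π y
        from a y eq = trans (cong (_-F π a) (trans eq (π-+ y a))) (//-rightDividesʳ (π a) (π y))

      fibre-const : Prime p → (∀ t → fibre π E t ≡ fibre π E 0F) ⊎
        (∀ t → fibre (λ v → -F π v) A t ≡ fibre (λ v → -F π v) A 0F)
      fibre-const pr = F-corr-const⇒const pr (fibre π E) (fibre (λ v → -F π v) A) λ t →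
        trans (fibre-corr t) (trans (line-const t) (sym (fibre-corr 0F)))

  -- Graphs from fibre counts, and the final case distinction

  Graph : SubsetV p → Set
  Graph E = ∃ λ (e₁ : V p) → ∃ λ (e₂ : V p) → ∃ λ (f : F p → F p) →
    IsBasis e₁ e₂
    × (∀ (v : V p) → (E v ≡ true) ⇔ (∃ λ (x : F p) → v ≡ (x ·V e₁) +V (f x ·V e₂)))
    × (∃ λ (c : Fin p → F p) → ∀ (x : F p) → f x ≡ evalPoly c x)

  -- A positive count supplies a point of `E` over each `t`, whose second coordinate defines `f t`;
  -- a second point in the same fibre would raise the count to 2.
  fibre≡1⇒graph : Prime p → ∀ E (K : Coordinates) → (∀ t → fibre (Coordinates.π K) E t ≡ 1) → Graph E
  fibre≡1⇒graph pr E K fibre≡1 = e₁ , e₂ , f , isBasis , (λ v → mk⇔ (to v) (from v)) , polynomial pr f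
    where
    open Coordinates K
    point : ∀ t → ∃ λ v → t ≡ π v × E v ≡ true
    point t = fibre>0⇒∃ π E t (ℕ.≤-reflexive (sym (fibre≡1 t)))
    f : F p → F p
    f t = σ (proj₁ (point t))
    point≡ : ∀ t → proj₁ (point t) ≡ (t ·V e₁) +V (f t ·V e₂)
    point≡ t = trans (comb _) (cong (λ s → (s ·V e₁) +V (f t ·V e₂)) (sym (proj₁ (proj₂ (point t)))))
    to : ∀ v → E v ≡ true → ∃ λ x → v ≡ (x ·V e₁) +V (f x ·V e₂)
    to v Ev with ≡-dec Fin._≟_ Fin._≟_ v (proj₁ (point (π v)))
    ... | yes v≡w = π v , trans v≡w (point≡ (π v))
    ... | no v≢w = contradiction (fibre-≥₂ π E v≢w refl (proj₁ (proj₂ (point (π v)))) Ev (proj₂ (proj₂ (point (π v)))))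
                     (ℕ.<⇒≱ (s≤s (ℕ.≤-reflexive (fibre≡1 (π v)))))
    from : ∀ v → (∃ λ x → v ≡ (x ·V e₁) +V (f x ·V e₂)) → E v ≡ true
    from v (x , v≡) = subst (λ w → E w ≡ true) (trans (point≡ x) (sym v≡)) (proj₂ (proj₂ (point x)))

  -- Meant for `m` the cardinality of the set with constant fibre count `c` and `n` the cardinality
  -- of the other set; with p prime, few values of `c` remain.
  p²-cofactor : ∀ {m n} c → m ℕ.* n ≡ p ℕ.* p → m ≡ p ℕ.* c → c ℕ.* n ≡ p
  p²-cofactor {m} {n} c mn≡p² m≡pc = ℕ.*-cancelˡ-≡ (c ℕ.* n) p p (begin
    p ℕ.* (c ℕ.* n)  ≡⟨ ℕ.*-assoc p c n ⟨
    p ℕ.* c ℕ.* n    ≡⟨ cong (ℕ._* n) m≡pc ⟨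
    m ℕ.* n          ≡⟨ mn≡p² ⟩
    p ℕ.* p          ∎)
    where open ≡-Reasoning

  p*n≡p⇒n≡1 : ∀ n → p ℕ.* n ≡ p → n ≡ 1
  p*n≡p⇒n≡1 n eq = ℕ.*-cancelˡ-≡ n 1 p (trans eq (sym (ℕ.*-identityʳ p)))

  factor : Prime p → ∀ c n → c ℕ.* n ≡ p → c ≡ 1 ⊎ (c ≡ p × n ≡ 1)
  factor pr c n cn≡p with prime⇒irreducible pr (ℕ∣.divides n (trans (sym cn≡p) (ℕ.*-comm c n)))
  ... | inj₁ c≡1 = inj₁ c≡1
  ... | inj₂ refl = inj₂ (refl , p*n≡p⇒n≡1 n cn≡p)

mainTheorem2 : (p : ℕ) .{{_ : NonZero p}} → Prime p →
    (E A : SubsetV p) → KTiles 1 E A →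
    ((card E ≡ 1) × (∀ (v : V p) → A v ≡ true))
    ⊎ ((∀ (v : V p) → E v ≡ true) × (card A ≡ 1))
    ⊎ (∃ λ (e₁ : V p) → ∃ λ (e₂ : V p) → ∃ λ (f : F p → F p) →
    IsBasis e₁ e₂
    × (∀ (v : V p) → (E v ≡ true) ⇔ (∃ λ (x : F p) → v ≡ (x ·V e₁) +V (f x ·V e₂)))
    × (∃ λ (c : Fin p → F p) → ∀ (x : F p) → f x ≡ evalPoly c x))
mainTheorem2 p pr E A tiles = go (card A) refl
  where
  open Plane p
  open Tiling {E} {A} tiles
  Goal : Set
  Goal = ((card E ≡ 1) × (∀ v → A v ≡ true)) ⊎ ((∀ v → E v ≡ true) × (card A ≡ 1)) ⊎ Graph E
  two-points : (∃ λ a → ∃ λ b → a ≢ b × A a ≡ true × A b ≡ true) → Goal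
  two-points (a , b , a≢b , Aa , Ab) = along (aligned pr a b)
    where
    along : (∃ λ K → Coordinates.π K a ≡ Coordinates.π K b) → Goal
    -- The projection is along `a - b`, so the two points of `A` lie in one fibre.
    along (K , πa≡πb) = Sum.[ E-const , A-const ] (fibre-const K pr)
      where
      open Coordinates K using (π)
      -π : V p → F p
      -π v = -F π v
      E-const : (∀ t → fibre π E t ≡ fibre π E 0F) → Goal
      E-const const with factor pr c (card A) (p²-cofactor c (trans (ℕ.*-comm (card E) (card A)) card-product) cardE≡)
        where
        c = fibre π E 0F
        cardE≡ = fibre-const⇒card π E c const
      ... | inj₁ c≡1 = inj₂ (inj₂ (fibre≡1⇒graph pr E K (λ t → trans (const t) c≡1)))
      ... | inj₂ (c≡p , cardA≡1) = inj₂ (inj₁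
        (card≡p²⇒full E (trans (fibre-const⇒card π E _ const) (cong (p ℕ.*_) c≡p)) , cardA≡1))
      A-const : (∀ t → fibre -π A t ≡ fibre -π A 0F) → Goal
      A-const const with factor pr c (card E) (p²-cofactor c card-product cardA≡)
        where
        c = fibre -π A 0F
        cardA≡ = fibre-const⇒card -π A c const
      -- The fibre shared by `a` and `b` has at least two points of `A`, which rules out the
      -- constant count 1.
      ... | inj₁ c≡1 = contradiction (fibre-≥₂ -π A a≢b refl (cong (λ t → -F t) πa≡πb) Aa Ab)
                         (ℕ.<⇒≱ (s≤s (ℕ.≤-reflexive (trans (const (-π a)) c≡1))))
      ... | inj₂ (c≡p , cardE≡1) = inj₁
        (cardE≡1 , card≡p²⇒full A (trans (fibre-const⇒card -π A _ const) (cong (p ℕ.*_) c≡p)))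
  go : ∀ n → card A ≡ n → Goal
  -- An empty `A` would make the product of the cardinalities 0 instead of the nonzero `p * p`.
  go 0 cardA≡0 = contradiction (trans (cong (ℕ._* card E) (sym cardA≡0)) card-product)
    (ℕ.<⇒≢ (ℕ.>-nonZero⁻¹ (p ℕ.* p) {{ℕ.m*n≢0 p p}}))
  go 1 cardA≡1 = inj₂ (inj₁ (card≡p²⇒full E
    (trans (sym (ℕ.*-identityˡ (card E))) (trans (cong (ℕ._* card E) (sym cardA≡1)) card-product)) , cardA≡1))
  go (suc (suc n)) cardA≡ = two-points
    (∑-indicator>1⇒∃₂ A allV-unique (subst (1 ℕ.<_) (sym cardA≡) (s≤s (s≤s z≤n))))
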